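{- Every Boolean doctrine over a small category is a quantifier-free fragment of its quantifier completion. That is: let $\mathsf{C}$ be a small category with finite products and $\mathbf{P}\colon\mathsf{C}^{\mathrm{op}}\to\mathsf{BA}$ a Boolean doctrine. Then $\mathbf{P}$ has a quantifier completion of the form $(\mathrm{id}_{\mathsf{C}},\mathfrak{i})\colon\mathbf{P}\to\mathbf{P}^{\forall\exists}$, and for any such quantifier completion the natural transformation $\mathfrak{i}$ is componentwise injective and its image is a quantifier-free fragment of $\mathbf{P}^{\forall\exists}$.
   Context: $\mathsf{BA}$ is the category of Boolean algebras and Boolean homomorphisms. A Boolean doctrine over a category $\mathsf{C}$ with finite products is a functor $\mathbf{P}\colon\mathsf{C}^{\mathrm{op}}\to\mathsf{BA}$. A Boolean doctrine morphism from $\mathbf{P}\colon\mathsf{C}^{\mathrm{op}}\to\mathsf{BA}$ to $\mathbf{R}\colon\mathsf{D}^{\mathrm{op}}\to\mathsf{BA}$ is a pair $(M,\mathfrak{m})$ with $M\colon\mathsf{C}\to\mathsf{D}$ a finite-product-preserving functor and $\mathfrak{m}\colon\mathbf{P}\to\mathbf{R}\circ M^{\mathrm{op}}$ a natural transformation; $(N,\mathfrak{n})\circ(M,\mathfrak{m})$ is $N\circ M$ together with the components $\mathfrak{n}_{M(X)}\circ\mathfrak{m}_X$. A Boolean doctrine $\mathbf{P}$ is a first-order Boolean doctrine if (i) for all $X,Y\in\mathsf{C}$ the map $\mathbf{P}(\mathrm{pr}_1)\colon\mathbf{P}(X)\to\mathbf{P}(X\times Y)$ has a right adjoint $(\forall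 Y)_X$ (as an order-preserving map); and (ii) for every $f\colon X'\to X$ and every $Y$, $\mathbf{P}(f)\circ(\forall Y)_X=(\forall Y)_{X'}\circ\mathbf{P}(f\times\mathrm{id}_Y)$. A first-order Boolean doctrine morphism is a Boolean doctrine morphism $(M,\mathfrak{m})$ between first-order Boolean doctrines with $\mathfrak{m}_X\circ(\forall Y)_X=(\forall M(Y))_{M(X)}\circ\mathfrak{m}_{X\times Y}$ for all $X,Y$. A quantifier completion of a Boolean doctrine $\mathbf{P}$ is a Boolean doctrine morphism $(I,\mathfrak{i})\colon\mathbf{P}\to\mathbf{P}^{\forall\exists}$ with $\mathbf{P}^{\forall\exists}$ a first-order Boolean doctrine, such that for every first-order Boolean doctrine $\mathbf{R}$ (over any base category) and every Boolean doctrine morphism $(M,\mathfrak{m})\colon\mathbf{P}\to\mathbf{R}$ there is a unique first-order Boolean doctrine morphism $(N,\mathfrak{n})\colon\mathbf{P}^{\forall\exists}\to\mathbf{R}$ with $(M,\mathfrak{m})=(N,\mathfrak{n})\circ(I,\mathfrak{i})$. A quantifier-free fragment of a first-order Boolean doctrine $\mathbf{Q}\colon\mathsf{C}^{\mathrm{op}}\to\mathsf{BA}$ is a subfunctor $\mathbf{Q}_0$ of $\mathbf{Q}$ (each $\mathbf{Q}_0(X)$ a Boolean subalgebra of $\mathbf{Q}(X)$, closed under reindexing) such that, for each $X$, $\mathbf{Q}(X)=\bigcup_{n\in\mathbb{N}}\mathbf{Q}_n(X)$, where, inductively, $\mathbf{Q}_{n+1}(X)$ is the Boolean subalgebra of $\mathbf{Q}(X)$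 generated by the union, over all objects $Y$, of the images of $\mathbf{Q}_n(X\times Y)$ under $(\forall Y)_X$. -}

module Defs where

open import Level using (Level; Setω; Lift; _⊔_) renaming (suc to lsuc)
open import Data.Nat.Base using (ℕ; zero; suc)
open import Data.Product.Base using (∃; _×_)
open import Data.Product using (∃!)
open import Function.Definitions using (Injective)
open import Algebra.Lattice.Bundles using (BooleanAlgebra)
open import Algebra.Lattice.Morphism.Structures using (IsLatticeHomomorphism)
import Algebra.Lattice.Morphism.Construct.Identity as Identity
import Algebra.Lattice.Morphism.Construct.Composition as Composition
import Algebra.Lattice.Properties.Lattice as LatticeProperties
open import Relation.Binary.Bundles using (Poset)
open import Relation.Binary.Core using (Rel)
open import Relation.Binary.Definitions using (Adjoint; _Respects_)
open import Relation.Binary.Structures using (IsEquivalence)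
open import Relation.Binary.PropositionalEquality.Core using (_≡_; refl)
open import Relation.Unary using (Pred; _∈_)

-- Hom-sets are setoids.  "Small" means that the objects, the morphisms
-- and their equality live in some fixed universes.

record Category (o ℓ e : Level) : Set (lsuc (o ⊔ ℓ ⊔ e)) where
  infix  4 _≈_ _⇒_
  infixr 9 _∘_
  field
    Obj       : Set o
    _⇒_       : Obj → Obj → Set ℓ
    _≈_       : ∀ {A B} → Rel (A ⇒ B) e
    id        : ∀ {A} → A ⇒ A
    _∘_       : ∀ {A B C} → B ⇒ C → A ⇒ B → A ⇒ C
    assoc     : ∀ {A B C D} {f : A ⇒ B} {g : B ⇒ C} {h : C ⇒ D} →
                (h ∘ g) ∘ f ≈ h ∘ (g ∘ f)
    identityˡ : ∀ {A B} {f : A ⇒ B} → id ∘ f ≈ f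
    identityʳ : ∀ {A B} {f : A ⇒ B} → f ∘ id ≈ f
    equiv     : ∀ {A B} → IsEquivalence (_≈_ {A} {B})
    ∘-resp-≈  : ∀ {A B C} {f h : B ⇒ C} {g i : A ⇒ B} →
                f ≈ h → g ≈ i → f ∘ g ≈ h ∘ i

  module Equiv {A B : Obj} = IsEquivalence (equiv {A} {B})

  hid : ∀ {A B} → A ≡ B → A ⇒ B
  hid refl = id

op : ∀ {o ℓ e} → Category o ℓ e → Category o ℓ e
op C = record
  { Obj       = Obj
  ; _⇒_       = λ A B → B ⇒ A
  ; _≈_       = _≈_
  ; id        = id
  ; _∘_       = λ f g → g ∘ f
  ; assoc     = Equiv.sym assoc
  ; identityˡ = identityʳ
  ; identityʳ = identityˡ
  ; equiv     = equiv
  ; ∘-resp-≈  = λ p q → ∘-resp-≈ q p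
  }
  where open Category C

record Functor {o ℓ e o′ ℓ′ e′} (C : Category o ℓ e) (D : Category o′ ℓ′ e′)
       : Set (o ⊔ ℓ ⊔ e ⊔ o′ ⊔ ℓ′ ⊔ e′) where
  private
    module C = Category C
    module D = Category D
  field
    F₀           : C.Obj → D.Obj
    F₁           : ∀ {A B} → A C.⇒ B → F₀ A D.⇒ F₀ B
    identity     : ∀ {A} → F₁ (C.id {A}) D.≈ D.id
    homomorphism : ∀ {X Y Z} {f : X C.⇒ Y} {g : Y C.⇒ Z} →
                   F₁ (g C.∘ f) D.≈ F₁ g D.∘ F₁ f
    F-resp-≈     : ∀ {A B} {f g : A C.⇒ B} → f C.≈ g → F₁ f D.≈ F₁ g

module _ {o ℓ e} {C : Category o ℓ e} where

  idF : Functor C C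
  idF = record
    { F₀           = λ X → X
    ; F₁           = λ f → f
    ; identity     = Equiv.refl
    ; homomorphism = Equiv.refl
    ; F-resp-≈     = λ p → p
    }
    where open Category C

module _ {o ℓ e o′ ℓ′ e′} {C : Category o ℓ e} {D : Category o′ ℓ′ e′} where

  opF : Functor C D → Functor (op C) (op D)
  opF F = record
    { F₀           = F₀
    ; F₁           = F₁
    ; identity     = identity
    ; homomorphism = homomorphism
    ; F-resp-≈     = F-resp-≈
    }
    where open Functor F

  -- Strict equality of functors: equal on objects and, up to the
  -- resulting identification of (co)domains, equal on morphisms.
  record _≡F_ (F G : Functor C D) : Set (o ⊔ ℓ ⊔ o′ ⊔ e′) where
    private
      module C = Category C
      module F = Functor F
      module G = Functor G
    open Category D
    field
      eq₀ : ∀ X → F.F₀ X ≡ G.F₀ X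
      eq₁ : ∀ {X Y} (f : X C.⇒ Y) →
            hid (eq₀ Y) ∘ F.F₁ f ≈ G.F₁ f ∘ hid (eq₀ X)

infixr 9 _∘F_
_∘F_ : ∀ {o ℓ e o′ ℓ′ e′ o″ ℓ″ e″} {C : Category o ℓ e}
       {D : Category o′ ℓ′ e′} {E : Category o″ ℓ″ e″} →
       Functor D E → Functor C D → Functor C E
_∘F_ {E = E} G F = record
  { F₀           = λ X → G.F₀ (F.F₀ X)
  ; F₁           = λ f → G.F₁ (F.F₁ f)
  ; identity     = Equiv.trans (G.F-resp-≈ F.identity) G.identity
  ; homomorphism = Equiv.trans (G.F-resp-≈ F.homomorphism) G.homomorphism
  ; F-resp-≈     = λ p → G.F-resp-≈ (F.F-resp-≈ p)
  }
  where
  open Category E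
  module F = Functor F
  module G = Functor G

module _ {o ℓ e} (C : Category o ℓ e) where
  open Category C

  record IsTerminal (T : Obj) : Set (o ⊔ ℓ ⊔ e) where
    field
      !        : ∀ {A} → A ⇒ T
      !-unique : ∀ {A} (f : A ⇒ T) → ! ≈ f

  record IsProduct {A B P : Obj} (p₁ : P ⇒ A) (p₂ : P ⇒ B)
         : Set (o ⊔ ℓ ⊔ e) where
    field
      ⟨_,_⟩    : ∀ {Z} → Z ⇒ A → Z ⇒ B → Z ⇒ P
      project₁ : ∀ {Z} {f : Z ⇒ A} {g : Z ⇒ B} → p₁ ∘ ⟨ f , g ⟩ ≈ f
      project₂ : ∀ {Z} {f : Z ⇒ A} {g : Z ⇒ B} → p₂ ∘ ⟨ f , g ⟩ ≈ g
      unique   : ∀ {Z} {h : Z ⇒ P} {f : Z ⇒ A} {g : Z ⇒ B} →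
                 p₁ ∘ h ≈ f → p₂ ∘ h ≈ g → ⟨ f , g ⟩ ≈ h

record CartesianCategory (o ℓ e : Level) : Set (lsuc (o ⊔ ℓ ⊔ e)) where
  infixr 7 _⊗_
  infixr 8 _⊗₁_
  field
    category : Category o ℓ e

  open Category category public

  field
    𝟙         : Obj
    isTerminal : IsTerminal category 𝟙
    _⊗_       : Obj → Obj → Obj
    π₁        : ∀ {A B} → A ⊗ B ⇒ A
    π₂        : ∀ {A B} → A ⊗ B ⇒ B
    isProduct : ∀ {A B} → IsProduct category (π₁ {A} {B}) (π₂ {A} {B})

  module _ {A B : Obj} where
    open IsProduct (isProduct {A} {B}) public

  _⊗₁_ : ∀ {A A′ B B′} → A ⇒ A′ → B ⇒ B′ → A ⊗ B ⇒ A′ ⊗ B′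
  f ⊗₁ g = ⟨ f ∘ π₁ , g ∘ π₂ ⟩

record PreservesFiniteProducts
       {o ℓ e o′ ℓ′ e′} {C : Category o ℓ e} {D : Category o′ ℓ′ e′}
       (F : Functor C D) : Set (o ⊔ ℓ ⊔ e ⊔ o′ ⊔ ℓ′ ⊔ e′) where
  open Category C using (Obj; _⇒_)
  open Functor F
  field
    terminal : ∀ {T} → IsTerminal C T → IsTerminal D (F₀ T)
    product  : ∀ {A B P : Obj} {p₁ : P ⇒ A} {p₂ : P ⇒ B} →
               IsProduct C p₁ p₂ → IsProduct D (F₁ p₁) (F₁ p₂)

idF-preserves : ∀ {o ℓ e} {C : Category o ℓ e} →
                PreservesFiniteProducts (idF {C = C})
idF-preserves = record { terminal = λ t → t ; product = λ p → p }

∘F-preserves : ∀ {o ℓ e o′ ℓ′ e′ o″ ℓ″ e″} {C : Category o ℓ e}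
               {D : Category o′ ℓ′ e′} {E : Category o″ ℓ″ e″}
               {G : Functor D E} {F : Functor C D} →
               PreservesFiniteProducts G → PreservesFiniteProducts F →
               PreservesFiniteProducts (G ∘F F)
∘F-preserves G F = record
  { terminal = λ t → G.terminal (F.terminal t)
  ; product  = λ p → G.product (F.product p)
  }
  where
  module G = PreservesFiniteProducts G
  module F = PreservesFiniteProducts F

record BooleanHom {a ℓ₁ b ℓ₂} (A : BooleanAlgebra a ℓ₁) (B : BooleanAlgebra b ℓ₂)
       : Set (a ⊔ ℓ₁ ⊔ b ⊔ ℓ₂) where
  private
    module A = BooleanAlgebra A
    module B = BooleanAlgebra B
  field
    ⟦_⟧                   : A.Carrier → B.Carrier
    isLatticeHomomorphism : IsLatticeHomomorphism A.rawLattice B.rawLattice ⟦_⟧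
    ⊤-homo                : ⟦ A.⊤ ⟧ B.≈ B.⊤
    ⊥-homo                : ⟦ A.⊥ ⟧ B.≈ B.⊥
    ¬-homo                : ∀ x → ⟦ A.¬ x ⟧ B.≈ B.¬ ⟦ x ⟧

  open IsLatticeHomomorphism isLatticeHomomorphism public

idᴮ : ∀ {a ℓ} {A : BooleanAlgebra a ℓ} → BooleanHom A A
idᴮ {A = A} = record
  { ⟦_⟧                   = λ x → x
  ; isLatticeHomomorphism = Identity.isLatticeHomomorphism rawLattice A.refl
  ; ⊤-homo                = A.refl
  ; ⊥-homo                = A.refl
  ; ¬-homo                = λ _ → A.refl
  }
  where
  module A = BooleanAlgebra A
  open A using (rawLattice)

infixr 9 _∘ᴮ_
_∘ᴮ_ : ∀ {a ℓ₁ b ℓ₂ c ℓ₃} {A : BooleanAlgebra a ℓ₁}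
       {B : BooleanAlgebra b ℓ₂} {C : BooleanAlgebra c ℓ₃} →
       BooleanHom B C → BooleanHom A B → BooleanHom A C
_∘ᴮ_ {C = C} g f = record
  { ⟦_⟧                   = λ x → g.⟦ f.⟦ x ⟧ ⟧
  ; isLatticeHomomorphism = Composition.isLatticeHomomorphism C.trans
                              f.isLatticeHomomorphism g.isLatticeHomomorphism
  ; ⊤-homo                = C.trans (g.⟦⟧-cong f.⊤-homo) g.⊤-homo
  ; ⊥-homo                = C.trans (g.⟦⟧-cong f.⊥-homo) g.⊥-homo
  ; ¬-homo                = λ x → C.trans (g.⟦⟧-cong (f.¬-homo x)) (g.¬-homo f.⟦ x ⟧)
  }
  where
  module C = BooleanAlgebra C
  module g = BooleanHom g
  module f = BooleanHom f

BA : ∀ c r → Category (lsuc (c ⊔ r)) (c ⊔ r) (c ⊔ r)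
BA c r = record
  { Obj       = BooleanAlgebra c r
  ; _⇒_       = BooleanHom
  ; _≈_       = λ {A} {B} f g → ∀ x → BooleanAlgebra._≈_ B (⟦ f ⟧ x) (⟦ g ⟧ x)
  ; id        = idᴮ
  ; _∘_       = _∘ᴮ_
  ; assoc     = λ {_} {_} {_} {D} _ → BooleanAlgebra.refl D
  ; identityˡ = λ {_} {B} _ → BooleanAlgebra.refl B
  ; identityʳ = λ {_} {B} _ → BooleanAlgebra.refl B
  ; equiv     = λ {_} {B} → record
    { refl  = λ _ → BooleanAlgebra.refl B
    ; sym   = λ p x → BooleanAlgebra.sym B (p x)
    ; trans = λ p q x → BooleanAlgebra.trans B (p x) (q x)
    }
  ; ∘-resp-≈  = λ {_} {_} {C} {f} {_} {_} {i} p q x →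
      BooleanAlgebra.trans C (⟦⟧-cong f (q x)) (p (⟦ i ⟧ x))
  }
  where open BooleanHom

record BooleanDoctrine {o ℓ e} (C : CartesianCategory o ℓ e) (c r : Level)
       : Set (o ⊔ ℓ ⊔ e ⊔ lsuc (c ⊔ r)) where
  open CartesianCategory C using (category; Obj; _⇒_)
  field
    functor : Functor (op category) (BA c r)

  fibre : Obj → BooleanAlgebra c r
  fibre = Functor.F₀ functor

  module Fibre (X : Obj) where
    open BooleanAlgebra (fibre X) public
    open Poset (LatticeProperties.poset lattice) public using (_≤_)

  ∣_∣ : Obj → Set c
  ∣ X ∣ = Fibre.Carrier X

  reindex : ∀ {X Y} → X ⇒ Y → ∣ Y ∣ → ∣ X ∣
  reindex f = BooleanHom.⟦_⟧ (Functor.F₁ functor f)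

-- Natural transformations of doctrines over one base.  The fibres are
-- allowed to live in different universes, so these are not literally
-- transformations between functors with the same codomain.
record _⇒ᴺ_ {o ℓ e c r c′ r′} {C : CartesianCategory o ℓ e}
            (P : BooleanDoctrine C c r) (Q : BooleanDoctrine C c′ r′)
            : Set (o ⊔ ℓ ⊔ c ⊔ r ⊔ c′ ⊔ r′) where
  open CartesianCategory C using (Obj; _⇒_)
  private
    module P = BooleanDoctrine P
    module Q = BooleanDoctrine Q
  field
    component : ∀ X → BooleanHom (P.fibre X) (Q.fibre X)

  η : ∀ X → P.∣ X ∣ → Q.∣ X ∣
  η X = BooleanHom.⟦_⟧ (component X)

  field
    natural : ∀ {X Y} (f : X ⇒ Y) (α : P.∣ Y ∣) →
              Q.Fibre._≈_ X (η X (P.reindex f α)) (Q.reindex f (η Y α))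

_∘ᵒᵖ_ : ∀ {o ℓ e o′ ℓ′ e′ c r} {C : CartesianCategory o ℓ e}
        {D : CartesianCategory o′ ℓ′ e′} → BooleanDoctrine D c r →
        Functor (CartesianCategory.category C) (CartesianCategory.category D) →
        BooleanDoctrine C c r
R ∘ᵒᵖ M = record { functor = BooleanDoctrine.functor R ∘F opF M }

record DoctrineMorphism {o ℓ e c r o′ ℓ′ e′ c′ r′}
         {C : CartesianCategory o ℓ e} {D : CartesianCategory o′ ℓ′ e′}
         (P : BooleanDoctrine C c r) (R : BooleanDoctrine D c′ r′)
         : Set (o ⊔ ℓ ⊔ e ⊔ c ⊔ r ⊔ o′ ⊔ ℓ′ ⊔ e′ ⊔ c′ ⊔ r′) where
  private
    module C = CartesianCategory C
    module D = CartesianCategory D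
  field
    functor   : Functor C.category D.category
    preserves : PreservesFiniteProducts functor
    transf    : _⇒ᴺ_ P (R ∘ᵒᵖ functor)

  open Functor functor public
  open _⇒ᴺ_ transf public

infixr 9 _∘ᴰ_
_∘ᴰ_ : ∀ {o ℓ e c r o′ ℓ′ e′ c′ r′ o″ ℓ″ e″ c″ r″}
       {C : CartesianCategory o ℓ e} {D : CartesianCategory o′ ℓ′ e′}
       {E : CartesianCategory o″ ℓ″ e″}
       {P : BooleanDoctrine C c r} {Q : BooleanDoctrine D c′ r′}
       {R : BooleanDoctrine E c″ r″} →
       DoctrineMorphism Q R → DoctrineMorphism P Q → DoctrineMorphism P R
_∘ᴰ_ {R = R} N M = record
  { functor   = N.functor ∘F M.functor
  ; preserves = ∘F-preserves N.preserves M.preserves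
  ; transf    = record
    { component = λ X → N.component (M.F₀ X) ∘ᴮ M.component X
    ; natural   = λ {X} f α → BooleanAlgebra.trans (BooleanDoctrine.fibre R _)
        (BooleanHom.⟦⟧-cong (N.component (M.F₀ X)) (M.natural f α))
        (N.natural (M.F₁ f) (M.η _ α))
    }
  }
  where
  module N = DoctrineMorphism N
  module M = DoctrineMorphism M

-- Equality of morphisms (M, 𝔪) and (M′, 𝔪′): M and M′ are equal, and
-- 𝔪_X = 𝔪′_X modulo the identification of R(M X) with R(M′ X).
record _≈ᴰ_ {o ℓ e c r o′ ℓ′ e′ c′ r′}
         {C : CartesianCategory o ℓ e} {D : CartesianCategory o′ ℓ′ e′}
         {P : BooleanDoctrine C c r} {R : BooleanDoctrine D c′ r′}
         (M M′ : DoctrineMorphism P R)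
         : Set (o ⊔ ℓ ⊔ c ⊔ o′ ⊔ e′ ⊔ r′) where
  private
    module C = CartesianCategory C
    module D = CartesianCategory D
    module P = BooleanDoctrine P
    module R = BooleanDoctrine R
    module M = DoctrineMorphism M
    module M′ = DoctrineMorphism M′
  field
    functor≡ : M.functor ≡F M′.functor

  open _≡F_ functor≡ public

  field
    transf≈ : ∀ X (α : P.∣ X ∣) →
              R.Fibre._≈_ (M.F₀ X) (M.η X α) (R.reindex (D.hid (eq₀ X)) (M′.η X α))

overIdentity : ∀ {o ℓ e c r c′ r′} {C : CartesianCategory o ℓ e}
               {P : BooleanDoctrine C c r} {Q : BooleanDoctrine C c′ r′} →
               _⇒ᴺ_ P Q → DoctrineMorphism P Q
overIdentity i = record
  { functor   = idF
  ; preserves = idF-preserves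
  ; transf    = record { component = component ; natural = natural }
  }
  where open _⇒ᴺ_ i

record IsFirstOrder {o ℓ e c r} {C : CartesianCategory o ℓ e}
                    (P : BooleanDoctrine C c r) : Set (o ⊔ ℓ ⊔ c ⊔ r) where
  open CartesianCategory C
  open BooleanDoctrine P
  field
    -- all Y X is (∀Y)_X.
    all            : ∀ Y X → ∣ X ⊗ Y ∣ → ∣ X ∣
    all-mono       : ∀ Y X {α β} →
                     Fibre._≤_ (X ⊗ Y) α β → Fibre._≤_ X (all Y X α) (all Y X β)
    adjoint        : ∀ Y X →
                     Adjoint (Fibre._≤_ X) (Fibre._≤_ (X ⊗ Y)) (reindex π₁) (all Y X)
    beck-chevalley : ∀ Y {X′ X} (f : X′ ⇒ X) (α : ∣ X ⊗ Y ∣) →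
                     Fibre._≈_ X′ (reindex f (all Y X α))
                                  (all Y X′ (reindex (f ⊗₁ id) α))

record FirstOrderDoctrine {o ℓ e} (C : CartesianCategory o ℓ e) (c r : Level)
       : Set (o ⊔ ℓ ⊔ e ⊔ lsuc (c ⊔ r)) where
  field
    doctrine     : BooleanDoctrine C c r
    isFirstOrder : IsFirstOrder doctrine

  open BooleanDoctrine doctrine public
  open IsFirstOrder isFirstOrder public

record FirstOrderMorphism {o ℓ e c r o′ ℓ′ e′ c′ r′}
         {C : CartesianCategory o ℓ e} {D : CartesianCategory o′ ℓ′ e′}
         (Q : FirstOrderDoctrine C c r) (R : FirstOrderDoctrine D c′ r′)
         : Set (o ⊔ ℓ ⊔ e ⊔ c ⊔ r ⊔ o′ ⊔ ℓ′ ⊔ e′ ⊔ c′ ⊔ r′) where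
  private
    module C = CartesianCategory C
    module D = CartesianCategory D
    module Q = FirstOrderDoctrine Q
    module R = FirstOrderDoctrine R
  field
    morphism : DoctrineMorphism Q.doctrine R.doctrine

  open DoctrineMorphism morphism public

  -- Since M preserves products, M(X × Y) is a product of M(X) and M(Y);
  -- this is the canonical isomorphism from the chosen one.
  comparison : ∀ X Y → F₀ X D.⊗ F₀ Y D.⇒ F₀ (X C.⊗ Y)
  comparison X Y = IsProduct.⟨_,_⟩
    (PreservesFiniteProducts.product preserves C.isProduct) D.π₁ D.π₂

  field
    preserves-all : ∀ Y X (α : Q.∣ X C.⊗ Y ∣) →
      R.Fibre._≈_ (F₀ X)
        (η X (Q.all Y X α))
        (R.all (F₀ Y) (F₀ X) (R.reindex (comparison X Y) (η (X C.⊗ Y) α)))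

-- The universal property concerns target doctrines in all universes,
-- hence Setω.
record IsQuantifierCompletion {o ℓ e c r o′ ℓ′ e′ c′ r′}
         {C : CartesianCategory o ℓ e} {D : CartesianCategory o′ ℓ′ e′}
         (P : BooleanDoctrine C c r) (Q : FirstOrderDoctrine D c′ r′)
         (I : DoctrineMorphism P (FirstOrderDoctrine.doctrine Q))
         : Setω where
  open FirstOrderMorphism using (morphism)
  field
    universal : ∀ {o″ ℓ″ e″ c″ r″} {E : CartesianCategory o″ ℓ″ e″}
      (R : FirstOrderDoctrine E c″ r″)
      (M : DoctrineMorphism P (FirstOrderDoctrine.doctrine R)) →
      ∃! {A = FirstOrderMorphism Q R}
         (λ N N′ → morphism N ≈ᴰ morphism N′)
         (λ N → M ≈ᴰ (morphism N ∘ᴰ I))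

record IsBooleanSubalgebra {a ℓ p} (B : BooleanAlgebra a ℓ)
         (S : Pred (BooleanAlgebra.Carrier B) p) : Set (a ⊔ ℓ ⊔ p) where
  open BooleanAlgebra B
  field
    resp     : S Respects _≈_
    ⊤-closed : ⊤ ∈ S
    ⊥-closed : ⊥ ∈ S
    ∧-closed : ∀ {x y} → x ∈ S → y ∈ S → x ∧ y ∈ S
    ∨-closed : ∀ {x y} → x ∈ S → y ∈ S → x ∨ y ∈ S
    ¬-closed : ∀ {x} → x ∈ S → ¬ x ∈ S

data Generated {a ℓ p} (B : BooleanAlgebra a ℓ)
       (S : Pred (BooleanAlgebra.Carrier B) p) :
       Pred (BooleanAlgebra.Carrier B) (a ⊔ ℓ ⊔ p) where
  gen  : ∀ {x} → x ∈ S → x ∈ Generated B S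
  resp : ∀ {x y} → BooleanAlgebra._≈_ B x y → x ∈ Generated B S → y ∈ Generated B S
  top  : BooleanAlgebra.⊤ B ∈ Generated B S
  bot  : BooleanAlgebra.⊥ B ∈ Generated B S
  meet : ∀ {x y} → x ∈ Generated B S → y ∈ Generated B S →
         BooleanAlgebra._∧_ B x y ∈ Generated B S
  join : ∀ {x y} → x ∈ Generated B S → y ∈ Generated B S →
         BooleanAlgebra._∨_ B x y ∈ Generated B S
  neg  : ∀ {x} → x ∈ Generated B S → BooleanAlgebra.¬_ B x ∈ Generated B S

module _ {o ℓ e c r} {p : Level} {C : CartesianCategory o ℓ e}
         (Q : FirstOrderDoctrine C c r) where
  open CartesianCategory C
  open FirstOrderDoctrine Q

  -- Stratum Q₀ n X is Q_n(X); the Lift only puts all strata in one universe.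
  Stratum : (∀ X → Pred ∣ X ∣ p) → ℕ → ∀ X → Pred ∣ X ∣ (o ⊔ c ⊔ r ⊔ p)
  Stratum Q₀ zero    X φ = Lift (o ⊔ c ⊔ r ⊔ p) (φ ∈ Q₀ X)
  Stratum Q₀ (suc n) X   = Generated (fibre X)
    (λ φ → ∃ λ Y → ∃ λ ψ → ψ ∈ Stratum Q₀ n (X ⊗ Y) × Fibre._≈_ X (all Y X ψ) φ)

  record IsQuantifierFreeFragment (Q₀ : ∀ X → Pred ∣ X ∣ p)
         : Set (o ⊔ ℓ ⊔ c ⊔ r ⊔ p) where
    field
      isSubalgebra : ∀ X → IsBooleanSubalgebra (fibre X) (Q₀ X)
      isSubfunctor : ∀ {X Y} (f : X ⇒ Y) {φ} → φ ∈ Q₀ Y → reindex f φ ∈ Q₀ X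
      exhaustive   : ∀ X φ → ∃ λ n → φ ∈ Stratum Q₀ n X

module _ {o ℓ e c r c′ r′} {C : CartesianCategory o ℓ e}
         {P : BooleanDoctrine C c r} {Q : BooleanDoctrine C c′ r′}
         (i : _⇒ᴺ_ P Q) where
  open CartesianCategory C using (Obj)
  open _⇒ᴺ_ i
  private
    module P = BooleanDoctrine P
    module Q = BooleanDoctrine Q

  ComponentwiseInjective : Set (o ⊔ c ⊔ r ⊔ r′)
  ComponentwiseInjective = ∀ X → Injective (P.Fibre._≈_ X) (Q.Fibre._≈_ X) (η X)

  Image : ∀ X → Pred Q.∣ X ∣ (c ⊔ r′)
  Image X φ = ∃ λ α → Q.Fibre._≈_ X (η X α) φ

record ∃ω {a} {A : Set a} (B : A → Setω) : Setω where
  constructor _,ω_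
  field
    witness : A
    proof   : B witness

record _×ω_ (A B : Setω) : Setω where
  constructor _,_
  field
    fst : A
    snd : B

infixr 2 _×ω_
infixr 4 _,ω_

{-# OPTIONS --safe #-}

-- The quantifier completion is the Lindenbaum–Tarski doctrine of formulas
-- built from the elements of P, so its elements lie in the strata over P.
-- A completion Q receives a morphism from the formulas and sends one back;
-- by uniqueness the composite is the identity of Q, which transfers the
-- stratification to Q.
--
-- For injectivity of 𝔦 at A it is enough to map P, injectively at A, into
-- some first-order doctrine R.  Classically one takes an ultrafilter U on
-- P(A) and sends α ∈ P(X) to { f : A → X ∣ P(f)(α) ∈ U }, a subset of
-- Hom(A , X).  To avoid choosing U, truth values are taken in the complete
-- Boolean algebra of subsets of P(A) that equal their own double polar (for
-- the relation x ∧ y = ⊥): R(X) consists of the functions from Hom(A , X) to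
-- this algebra, ∀ is an infimum over Hom(A , Y), and α goes to
-- f ↦ { x ∣ x ≤ P(f)(α) }.  At f = id this determines α.

module Submission where

open import Level using (Level; _⊔_; Lift; lift; lower) renaming (suc to lsuc)
open import Data.Nat.Base using (ℕ; zero; suc; _≤′_; ≤′-refl; ≤′-step) renaming (_⊔_ to _⊔ⁿ_)
open import Data.Nat.Properties using (≤⇒≤′; m≤m⊔n; m≤n⊔m)
open import Data.Product.Base using (∃; _×_; _,_; proj₁; proj₂)
open import Data.Unit.Polymorphic.Base using (tt) renaming (⊤ to Unit)
open import Function.Definitions using (Injective)
open import Algebra.Lattice.Bundles using (BooleanAlgebra)
open import Algebra.Lattice.Structures.Biased using (isBooleanAlgebraʳ; isDistributiveLatticeʳʲᵐ)
import Algebra.Lattice.Properties.BooleanAlgebra as BooleanAlgebraProperties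
import Algebra.Lattice.Properties.Lattice as LatticeProperties
open import Relation.Binary.Bundles using (Setoid)
import Relation.Binary.Lattice as OrderLattice
import Relation.Binary.Lattice.Properties.DistributiveLattice as OrderDistributiveProperties
import Relation.Binary.Lattice.Properties.Lattice as OrderLatticeProperties
open import Relation.Binary.PropositionalEquality.Core using (_≡_; refl) renaming (sym to ≡-sym)
import Relation.Binary.Reasoning.Setoid as ≈-Reasoning
open import Relation.Unary using (Pred; _∈_)
open import Defs

-- Order and disjointness in a Boolean algebra.

module BooleanOrder {b ℓ} (B : BooleanAlgebra b ℓ) where
  open BooleanAlgebra B public
  open BooleanAlgebraProperties B public
    using (∧-identityʳ; ∨-identityˡ; ∧-zeroʳ; ¬-involutive; deMorgan₁; ¬⊥≈⊤)
  open LatticeProperties lattice public using (∧-idem)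
  open OrderLattice.Lattice (LatticeProperties.∨-∧-orderTheoreticLattice lattice) public
    using (_≤_; x∧y≤x; x∧y≤y; ∧-greatest; antisym)
    renaming (refl to ≤-refl; reflexive to ≤-reflexive; trans to ≤-trans)

  infix 4 _⟂_
  _⟂_ : Carrier → Carrier → Set ℓ
  x ⟂ y = x ∧ y ≈ ⊥

  ⟂-sym : ∀ {x y} → x ⟂ y → y ⟂ x
  ⟂-sym x⟂y = trans (∧-comm _ _) x⟂y

  ≤⊥⇒≈⊥ : ∀ {x} → x ≤ ⊥ → x ≈ ⊥
  ≤⊥⇒≈⊥ x≤⊥ = trans x≤⊥ (∧-zeroʳ _)

  ⟂-antitoneˡ : ∀ {x y z} → x ≤ y → y ⟂ z → x ⟂ z
  ⟂-antitoneˡ x≤y y⟂z = ≤⊥⇒≈⊥ (≤-trans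
    (∧-greatest (≤-trans (x∧y≤x _ _) x≤y) (x∧y≤y _ _)) (≤-reflexive y⟂z))

  -- Split `x` as `(x ∧ y) ∨ (x ∧ ¬ y)`; the first part vanishes.
  ⟂⇒≤¬ : ∀ {x y} → x ⟂ y → x ≤ ¬ y
  ⟂⇒≤¬ {x} {y} x⟂y =
    trans (sym (∧-identityʳ x))
    (trans (∧-congˡ (sym (∨-complementʳ y)))
    (trans (∧-distribˡ-∨ x y (¬ y))
    (trans (∨-congʳ x⟂y) (∨-identityˡ _))))

  ≤¬⇒⟂ : ∀ {x y} → x ≤ ¬ y → x ⟂ y
  ≤¬⇒⟂ x≤¬y = ⟂-antitoneˡ x≤¬y (∧-complementˡ _)

  ⟂-self⇒≈⊥ : ∀ {x} → x ⟂ x → x ≈ ⊥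
  ⟂-self⇒≈⊥ x⟂x = trans (sym (∧-idem _)) x⟂x

  ≈⊥⇒⟂ : ∀ {x y} → x ≈ ⊥ → y ⟂ x
  ≈⊥⇒⟂ x≈⊥ = trans (∧-congˡ x≈⊥) (∧-zeroʳ _)

  ∧⟂⇒⟂∧ : ∀ {x y z} → z ∧ x ⟂ y → z ⟂ y ∧ x
  ∧⟂⇒⟂∧ p = trans (∧-congˡ (∧-comm _ _)) (trans (sym (∧-assoc _ _ _)) p)

  ∧⟂⇒⟂ : ∀ {x y} → y ∧ x ⟂ x → y ⟂ x
  ∧⟂⇒⟂ p = trans (∧-congˡ (sym (∧-idem _))) (trans (sym (∧-assoc _ _ _)) p)

  ¬⟂⇒≤ : ∀ {x y} → ¬ y ⟂ x → x ≤ y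
  ¬⟂⇒≤ ¬y⟂x = ≤-trans (⟂⇒≤¬ (⟂-sym ¬y⟂x)) (≤-reflexive (¬-involutive _))

-- Boolean homomorphisms from meets and complements.

module _ {a ℓ₁ b ℓ₂} (A : BooleanAlgebra a ℓ₁) (B : BooleanAlgebra b ℓ₂) where
  private
    module A = BooleanOrder A
    module B = BooleanOrder B

  -- Joins follow by De Morgan's laws, bottom from `⊥ ∧ ¬ ⊥`, and top as the complement of bottom.
  ∧-¬-booleanHom : (f : A.Carrier → B.Carrier) →
                   (∀ {x y} → x A.≈ y → f x B.≈ f y) →
                   (∀ x y → f (x A.∧ y) B.≈ f x B.∧ f y) →
                   (∀ x → f (A.¬ x) B.≈ B.¬ f x) →
                   BooleanHom A B
  ∧-¬-booleanHom f cong ∧-homo ¬-homo = record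
    { ⟦_⟧                   = f
    ; isLatticeHomomorphism = record
      { isRelHomomorphism = record { cong = cong }
      ; ∧-homo            = ∧-homo
      ; ∨-homo            = ∨-homo
      }
    ; ⊤-homo                = ⊤-homo
    ; ⊥-homo                = ⊥-homo
    ; ¬-homo                = ¬-homo
    }
    where
    ∨-homo : ∀ x y → f (x A.∨ y) B.≈ f x B.∨ f y
    ∨-homo x y =
      B.trans (cong (A.sym (A.trans (A.deMorgan₁ (A.¬ x) (A.¬ y))
        (A.∨-cong (A.¬-involutive x) (A.¬-involutive y)))))
      (B.trans (¬-homo _)
      (B.trans (B.¬-cong (B.trans (∧-homo _ _) (B.∧-cong (¬-homo x) (¬-homo y))))
      (B.trans (B.deMorgan₁ _ _) (B.∨-cong (B.¬-involutive _) (B.¬-involutive _)))))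
    ⊥-homo : f A.⊥ B.≈ B.⊥
    ⊥-homo = B.trans (cong (A.sym (A.∧-complementʳ A.⊥)))
      (B.trans (∧-homo _ _) (B.trans (B.∧-congˡ (¬-homo _)) (B.∧-complementʳ _)))
    ⊤-homo : f A.⊤ B.≈ B.⊤
    ⊤-homo = B.trans (cong (A.sym A.¬⊥≈⊤))
      (B.trans (¬-homo _) (B.trans (B.¬-cong ⊥-homo) B.¬⊥≈⊤))

-- The Boolean algebra of families of regular sets.

module RegularSets {b ℓ i ℓi} (B : BooleanAlgebra b ℓ) (I : Setoid i ℓi) (q : Level) where
  private module I = Setoid I
  open BooleanOrder B

  -- Since `⟂` is symmetric, polars form a Galois connection of subsets with themselves; the closed
  -- subsets play the role of regular open sets. `q` leaves room for predicates that quantify over a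
  -- further universe.
  Polar : Pred Carrier (b ⊔ ℓ ⊔ q) → Pred Carrier (b ⊔ ℓ ⊔ q)
  Polar U y = ∀ z → U z → z ⟂ y

  -- One element is a whole family over `I`, so that truth values and functions into them are built
  -- at once. `stable` is one inclusion; the opposite one holds for every set by symmetry of `⟂`.
  record Regular : Set (lsuc (b ⊔ ℓ ⊔ q) ⊔ i ⊔ ℓi) where
    field
      member   : I.Carrier → Pred Carrier (b ⊔ ℓ ⊔ q)
      respects : ∀ {j k} → j I.≈ k → ∀ {x} → member j x → member k x
      stable   : ∀ j {x} → Polar (Polar (member j)) x → member j x

    -- Every polar is closed downwards, and `stable` identifies `member j` with its double polar.
    downward : ∀ j {x y} → x ≤ y → member j y → member j x
    downward j x≤y y∈ = stable j λ z z∈ → ⟂-sym (⟂-antitoneˡ x≤y (z∈ _ y∈))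

    ⊥-member : ∀ j {x} → x ≈ ⊥ → member j x
    ⊥-member j x≈⊥ = stable j λ z _ → ≈⊥⇒⟂ x≈⊥

  open Regular public

  infix 4 _⊑_ _≋_
  _⊑_ _≋_ : Regular → Regular → Set (i ⊔ b ⊔ ℓ ⊔ q)
  U ⊑ V = ∀ j x → member U j x → member V j x
  U ≋ V = (U ⊑ V) × (V ⊑ U)

  infixr 7 _⊓_
  _⊓_ : Regular → Regular → Regular
  U ⊓ V = record
    { member   = λ j x → member U j x × member V j x
    ; respects = λ j≈k (x∈U , x∈V) → respects U j≈k x∈U , respects V j≈k x∈V
    ; stable   = λ j x∈ →
        stable U j (λ y y∈ → x∈ y λ z (z∈U , _) → y∈ z z∈U) ,
        stable V j (λ y y∈ → x∈ y λ z (_ , z∈V) → y∈ z z∈V)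
    }

  ∁ : Regular → Regular
  ∁ U = record
    { member   = λ j → Polar (member U j)
    ; respects = λ j≈k x∈ z z∈ → x∈ z (respects U (I.sym j≈k) z∈)
    ; stable   = λ j x∈ z z∈ → x∈ z λ y y∈ → ⟂-sym (y∈ z z∈)
    }

  full : Regular
  full = record
    { member   = λ _ _ → Unit
    ; respects = λ _ _ → tt
    ; stable   = λ _ _ → tt
    }

  infixr 6 _⊔ᴿ_
  -- De Morgan's formula yields the double polar of the union.
  _⊔ᴿ_ : Regular → Regular → Regular
  U ⊔ᴿ V = ∁ (∁ U ⊓ ∁ V)

  orderTheoreticLattice : OrderLattice.DistributiveLattice _ _ _
  orderTheoreticLattice = record
    { Carrier = Regular
    ; _≈_     = _≋_
    ; _≤_     = _⊑_
    ; _∨_     = _⊔ᴿ_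
    ; _∧_     = _⊓_
    ; isDistributiveLattice = record
      { isLattice = record
        { isPartialOrder = record
          { isPreorder = record
            { isEquivalence = record
              { refl  = (λ _ _ x∈ → x∈) , (λ _ _ x∈ → x∈)
              ; sym   = λ (p , q) → q , p
              ; trans = λ (p , q) (p′ , q′) →
                  (λ j x x∈ → p′ j x (p j x x∈)) , (λ j x x∈ → q j x (q′ j x x∈))
              }
            ; reflexive = proj₁
            ; trans     = λ p q j x x∈ → q j x (p j x x∈)
            }
          ; antisym = _,_
          }
        ; supremum = λ U V →
            (λ j x x∈ y (y∈ , _) → ⟂-sym (y∈ x x∈)) ,
            (λ j x x∈ y (_ , y∈) → ⟂-sym (y∈ x x∈)) ,
            -- An element `y` of the polar of `W` lies in the polars of `U` and `V`, hence is
            -- disjoint from `x`; stability of `W` concludes.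
            (λ W U⊑W V⊑W j x x∈ → stable W j λ y y∈ → x∈ y
              ((λ z z∈ → y∈ z (U⊑W j z z∈)) , (λ z z∈ → y∈ z (V⊑W j z z∈))))
        ; infimum = λ U V → (λ _ _ → proj₁) , (λ _ _ → proj₂) ,
            (λ W p q j x x∈ → p j x x∈ , q j x x∈)
        }
      ; ∧-distribˡ-∨ = λ U V W →
          (λ j x (x∈U , x∈V∨W) y (y∈ , y∈′) →
            -- The element to test is `y ∧ x`. For `z` in `V`, `z ∧ x` lies in both `U` and `V`, so
            -- it is disjoint from `y`; hence `z` is disjoint from `y ∧ x`. The same holds for `W`,
            -- so `y ∧ x`, and with it `y`, is disjoint from `x`.
            ∧⟂⇒⟂ (x∈V∨W (y ∧ x)
              ( (λ z z∈ → ∧⟂⇒⟂∧ (y∈ (z ∧ x)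
                  (downward U j (x∧y≤y z x) x∈U , downward V j (x∧y≤x z x) z∈)))
              , (λ z z∈ → ∧⟂⇒⟂∧ (y∈′ (z ∧ x)
                  (downward U j (x∧y≤y z x) x∈U , downward W j (x∧y≤x z x) z∈)))))) ,
          (λ j x x∈ →
            stable U j (λ y y∈ → x∈ y ((λ z (z∈U , _) → y∈ z z∈U) , (λ z (z∈U , _) → y∈ z z∈U))) ,
            (λ y (y∈ , y∈′) → x∈ y ((λ z (_ , z∈) → y∈ z z∈) , (λ z (_ , z∈) → y∈′ z z∈))))
      }
    }

  private
    module D = OrderLattice.DistributiveLattice orderTheoreticLattice

  booleanAlgebra : BooleanAlgebra (lsuc (b ⊔ ℓ ⊔ q) ⊔ i ⊔ ℓi) (i ⊔ b ⊔ ℓ ⊔ q)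
  booleanAlgebra = record
    { Carrier          = Regular
    ; _≈_              = _≋_
    ; _∨_              = _⊔ᴿ_
    ; _∧_              = _⊓_
    ; ¬_               = ∁
    ; ⊤                = full
    -- Only elements equal to `⊥` are disjoint from everything: the least regular set consists of
    -- these and is not empty.
    ; ⊥                = ∁ full
    ; isBooleanAlgebra = isBooleanAlgebraʳ (record
      { isDistributiveLattice = record
        { isLattice   = OrderLatticeProperties.isAlgLattice D.lattice
        ; ∨-distrib-∧ = OrderDistributiveProperties.∨-distrib-∧ orderTheoreticLattice
        ; ∧-distrib-∨ = OrderDistributiveProperties.∧-distrib-∨ orderTheoreticLattice
        }
      ; ∨-complementʳ = λ U →
          (λ _ _ _ → tt) ,
          -- An element of a polar and of its polar is disjoint from itself, hence equals `⊥`; this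
          -- replaces excluded middle.
          (λ j x _ y (y∈ , y∈′) → ⟂-sym (≈⊥⇒⟂ (⟂-self⇒≈⊥ (y∈′ y y∈))))
      ; ∧-complementʳ = λ U →
          (λ j x (x∈ , x∈′) y _ → ≈⊥⇒⟂ (⟂-self⇒≈⊥ (x∈′ x x∈))) ,
          (λ j x x∈ → ⊥-member U j (⟂-self⇒≈⊥ (x∈ x tt)) ,
                      ⊥-member (∁ U) j (⟂-self⇒≈⊥ (x∈ x tt)))
      ; ¬-cong        = λ (p , q) →
          (λ j x x∈ z z∈ → x∈ z (q j z z∈)) , (λ j x x∈ z z∈ → x∈ z (p j z z∈))
      })
    }

-- Hom-setoids and finite products.

module _ {o ℓ e} {C : Category o ℓ e} where
  open Category C

  homSetoid : Obj → Obj → Setoid ℓ e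
  homSetoid X Y = record { Carrier = X ⇒ Y ; _≈_ = _≈_ ; isEquivalence = equiv }

  pullˡ : ∀ {W X Y Z} {h : Y ⇒ Z} {g : X ⇒ Y} {k : X ⇒ Z} {f : W ⇒ X} →
          h ∘ g ≈ k → h ∘ (g ∘ f) ≈ k ∘ f
  pullˡ hg≈k = Equiv.trans (Equiv.sym assoc) (∘-resp-≈ hg≈k Equiv.refl)

  jointly-monic : ∀ {X Y P Z} {p₁ : P ⇒ X} {p₂ : P ⇒ Y} → IsProduct C p₁ p₂ →
                  {h k : Z ⇒ P} → p₁ ∘ h ≈ p₁ ∘ k → p₂ ∘ h ≈ p₂ ∘ k → h ≈ k
  jointly-monic p e₁ e₂ = Equiv.trans (Equiv.sym (unique e₁ e₂)) (unique Equiv.refl Equiv.refl)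
    where open IsProduct p

module CartesianProperties {o ℓ e} (C : CartesianCategory o ℓ e) where
  open CartesianCategory C

  ⟨⟩-cong : ∀ {X Y Z} {f f′ : Z ⇒ X} {g g′ : Z ⇒ Y} →
            f ≈ f′ → g ≈ g′ → ⟨ f , g ⟩ ≈ ⟨ f′ , g′ ⟩
  ⟨⟩-cong f≈f′ g≈g′ = unique (Equiv.trans project₁ (Equiv.sym f≈f′))
                             (Equiv.trans project₂ (Equiv.sym g≈g′))

  ⊗₁∘⟨⟩ : ∀ {X X′ Y Y′ Z} {f : X ⇒ X′} {g : Y ⇒ Y′} {h : Z ⇒ X} {k : Z ⇒ Y} →
          (f ⊗₁ g) ∘ ⟨ h , k ⟩ ≈ ⟨ f ∘ h , g ∘ k ⟩
  ⊗₁∘⟨⟩ = Equiv.sym (unique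
    (Equiv.trans (pullˡ {C = category} project₁)
      (Equiv.trans assoc (∘-resp-≈ Equiv.refl project₁)))
    (Equiv.trans (pullˡ {C = category} project₂)
      (Equiv.trans assoc (∘-resp-≈ Equiv.refl project₂))))

-- The doctrine of regular families over hom-sets.

module PointwiseDoctrine {o ℓ e c r} {C : CartesianCategory o ℓ e}
         (P : BooleanDoctrine C c r) (A : CartesianCategory.Obj C) where
  open CartesianCategory C
  open CartesianProperties C
  private
    module P = BooleanDoctrine P
    module PA = BooleanOrder (P.fibre A)
    module Hom = Functor P.functor
    -- The extra universe is that of the morphisms, so that an intersection over all `A ⇒ Y` is
    -- again such a set.
    module Sets (X : Obj) = RegularSets (P.fibre A) (homSetoid {C = category} A X) ℓ
  open Sets using (Regular; member; respects; stable; _⊑_; _≋_; booleanAlgebra)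

  pullback : ∀ {X Y} → X ⇒ Y → Regular Y → Regular X
  pullback {X} {Y} f U = record
    { member   = λ j → member U (f ∘ j)
    ; respects = λ j≈k → respects U (∘-resp-≈ Equiv.refl j≈k)
    ; stable   = λ j → stable U (f ∘ j)
    }

  pullbackHom : ∀ {X Y} → X ⇒ Y → BooleanHom (booleanAlgebra Y) (booleanAlgebra X)
  pullbackHom {X} {Y} f = ∧-¬-booleanHom (booleanAlgebra Y) (booleanAlgebra X) (pullback f)
    (λ (U⊑V , V⊑U) → (λ j → U⊑V (f ∘ j)) , (λ j → V⊑U (f ∘ j)))
    -- Meets and complements are computed index by index, so precomposition preserves them
    -- definitionally.
    (λ U V → BooleanAlgebra.refl (booleanAlgebra X) {pullback f (Sets._⊓_ Y U V)})
    (λ U → BooleanAlgebra.refl (booleanAlgebra X) {pullback f (Sets.∁ Y U)})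

  doctrine : BooleanDoctrine C _ _
  doctrine = record { functor = record
    { F₀           = booleanAlgebra
    ; F₁           = pullbackHom
    ; identity     = λ {X} U →
        (λ j x → respects U identityˡ) , (λ j x → respects U (Equiv.sym identityˡ))
    ; homomorphism = λ {X} U →
        (λ j x → respects U assoc) , (λ j x → respects U (Equiv.sym assoc))
    ; F-resp-≈     = λ {X} f≈g U →
        (λ j x → respects U (∘-resp-≈ f≈g Equiv.refl)) ,
        (λ j x → respects U (∘-resp-≈ (Equiv.sym f≈g) Equiv.refl))
    } }

  private module D = BooleanDoctrine doctrine

  ⊑⇒≤ : ∀ X {U V} → _⊑_ X U V → D.Fibre._≤_ X U V
  ⊑⇒≤ X U⊑V = (λ j x x∈ → x∈ , U⊑V j x x∈) , (λ j x → proj₁)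

  ≤⇒⊑ : ∀ X {U V} → D.Fibre._≤_ X U V → _⊑_ X U V
  ≤⇒⊑ X (U⊑U∧V , _) j x x∈ = proj₂ (U⊑U∧V j x x∈)

  -- An intersection of regular sets needs no closure: an element of the polar of one of them is
  -- also in the polar of the intersection.
  ⋀ : ∀ Y X → Regular (X ⊗ Y) → Regular X
  ⋀ Y X U = record
    { member   = λ j x → ∀ (k : A ⇒ Y) → member U ⟨ j , k ⟩ x
    ; respects = λ j≈j′ x∈ k → respects U (⟨⟩-cong j≈j′ Equiv.refl) (x∈ k)
    ; stable   = λ j x∈ k → stable U ⟨ j , k ⟩ λ y y∈ →
        x∈ y λ z z∈ → y∈ z (z∈ k)
    }

  ⋀-mono : ∀ Y X {U V} → _⊑_ (X ⊗ Y) U V → _⊑_ X (⋀ Y X U) (⋀ Y X V)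
  ⋀-mono Y X U⊑V j x x∈ k = U⊑V ⟨ j , k ⟩ x (x∈ k)

  isFirstOrder : IsFirstOrder doctrine
  isFirstOrder = record
    { all            = ⋀
    ; all-mono       = λ Y X {U} {V} U≤V →
        ⊑⇒≤ X {⋀ Y X U} {⋀ Y X V} (⋀-mono Y X {U} {V} (≤⇒⊑ (X ⊗ Y) {U} {V} U≤V))
    ; adjoint        = λ Y X {U} {V} →
        (λ p → ⊑⇒≤ X {U} {⋀ Y X V} λ j x x∈ k →
          ≤⇒⊑ (X ⊗ Y) {pullback π₁ U} {V} p ⟨ j , k ⟩ x (respects U (Equiv.sym project₁) x∈)) ,
        (λ p → ⊑⇒≤ (X ⊗ Y) {pullback π₁ U} {V} λ j x x∈ →
          -- Every `j : A ⇒ X ⊗ Y` is the pairing of its projections, so the instance `k = π₂ ∘ j`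
          -- of the infimum is the one wanted.
          respects V (unique Equiv.refl Equiv.refl)
            (≤⇒⊑ X {U} {⋀ Y X V} p (π₁ ∘ j) x x∈ (π₂ ∘ j)))
    -- Both sides range over the same `k : A ⇒ Y`, since `f ⊗₁ id` changes only the first component
    -- of a pairing.
    ; beck-chevalley = λ Y {X′} {X} f U →
        (λ j x x∈ k → respects U (Equiv.sym (⊗id∘⟨⟩ f j k)) (x∈ k)) ,
        (λ j x x∈ k → respects U (⊗id∘⟨⟩ f j k) (x∈ k))
    }
    where
    ⊗id∘⟨⟩ : ∀ {X X′ Y Z} (f : X′ ⇒ X) (j : Z ⇒ X′) (k : Z ⇒ Y) →
             (f ⊗₁ id) ∘ ⟨ j , k ⟩ ≈ ⟨ f ∘ j , k ⟩
    ⊗id∘⟨⟩ f j k = Equiv.trans ⊗₁∘⟨⟩ (⟨⟩-cong Equiv.refl identityˡ)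

  firstOrder : FirstOrderDoctrine C _ _
  firstOrder = record { doctrine = doctrine ; isFirstOrder = isFirstOrder }

  principal : ∀ X → P.∣ X ∣ → Regular X
  principal X α = record
    { member   = λ j x → Lift (c ⊔ ℓ ⊔ r) (x PA.≤ P.reindex j α)
    ; respects = λ j≈k (lift x≤) → lift (PA.≤-trans x≤ (PA.≤-reflexive (Hom.F-resp-≈ j≈k α)))
    -- The omitted witness is the complement of `P.reindex j α`: it lies in the polar, and
    -- disjointness of `x` from it puts `x` below `P.reindex j α`.
    ; stable   = λ j x∈ → lift (PA.¬⟂⇒≤ (x∈ _ λ z (lift z≤) →
        PA.≤¬⇒⟂ (PA.≤-trans z≤ (PA.≤-reflexive (PA.sym (PA.¬-involutive _))))))
    }

  principalHom : ∀ X → BooleanHom (P.fibre X) (booleanAlgebra X)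
  principalHom X = ∧-¬-booleanHom (P.fibre X) (booleanAlgebra X) (principal X)
    (λ α≈β →
      (λ j x (lift x≤) → lift (PA.≤-trans x≤ (PA.≤-reflexive (⟦⟧-cong (Hom.F₁ j) α≈β)))) ,
      (λ j x (lift x≤) → lift (PA.≤-trans x≤ (PA.≤-reflexive (PA.sym (⟦⟧-cong (Hom.F₁ j) α≈β))))))
    (λ α β →
      (λ j x (lift x≤) → let x≤∧ = PA.≤-trans x≤ (PA.≤-reflexive (∧-homo (Hom.F₁ j) α β)) in
        lift (PA.≤-trans x≤∧ (PA.x∧y≤x _ _)) , lift (PA.≤-trans x≤∧ (PA.x∧y≤y _ _))) ,
      (λ j x (lift x≤ , lift x≤′) → lift (PA.≤-trans (PA.∧-greatest x≤ x≤′)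
        (PA.≤-reflexive (PA.sym (∧-homo (Hom.F₁ j) α β))))))
    (λ α →
      (λ j x (lift x≤) z (lift z≤) → PA.⟂-antitoneˡ z≤ (PA.⟂-sym (PA.≤¬⇒⟂
        (PA.≤-trans x≤ (PA.≤-reflexive (¬-homo (Hom.F₁ j) α)))))) ,
      -- Here the polar is tested on the largest member, `P.reindex j α` itself.
      (λ j x x∈ → lift (PA.≤-trans (PA.⟂⇒≤¬ (PA.⟂-sym (x∈ _ (lift PA.≤-refl))))
        (PA.≤-reflexive (PA.sym (¬-homo (Hom.F₁ j) α))))))
    where open BooleanHom

  embedding : P ⇒ᴺ doctrine
  embedding = record
    { component = principalHom
    ; natural   = λ f α →
        (λ j x (lift x≤) → lift (PA.≤-trans x≤ (PA.≤-reflexive (PA.sym (Hom.homomorphism α))))) ,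
        (λ j x (lift x≤) → lift (PA.≤-trans x≤ (PA.≤-reflexive (Hom.homomorphism α))))
    }

  principal-injective : Injective (P.Fibre._≈_ A) (_≋_ A) (principal A)
  principal-injective {α} {β} (α⊑β , β⊑α) =
    PA.antisym (reflect {α} {β} α⊑β) (reflect {β} {α} β⊑α)
    where
    reflect : ∀ {α β} → _⊑_ A (principal A α) (principal A β) → α PA.≤ β
    reflect {α} {β} p = PA.≤-trans
      (lower (p id α (lift (PA.≤-reflexive (PA.sym (Hom.identity α))))))
      (PA.≤-reflexive (Hom.identity β))

-- Reindexing and quantifiers in a doctrine.

module DoctrineProperties {o ℓ e c r} {C : CartesianCategory o ℓ e}
         (R : BooleanDoctrine C c r) where
  open CartesianCategory C
  open BooleanDoctrine R public
  private module R₁ = Functor functor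

  module Order (X : Obj) = BooleanOrder (fibre X)

  fibreSetoid : Obj → Setoid c r
  fibreSetoid X = record { isEquivalence = Fibre.isEquivalence X }

  reindex-cong : ∀ {X Y} {f g : X ⇒ Y} {α β} → f ≈ g → Fibre._≈_ Y α β →
                 Fibre._≈_ X (reindex f α) (reindex g β)
  reindex-cong {X} {f = f} {β = β} f≈g α≈β =
    Fibre.trans X (BooleanHom.⟦⟧-cong (R₁.F₁ f) α≈β) (R₁.F-resp-≈ f≈g β)

  reindex-congʳ : ∀ {X Y} (f : X ⇒ Y) {α β} → Fibre._≈_ Y α β →
                  Fibre._≈_ X (reindex f α) (reindex f β)
  reindex-congʳ f = reindex-cong Equiv.refl

  reindex-id : ∀ {X} {f : X ⇒ X} → f ≈ id → ∀ α → Fibre._≈_ X (reindex f α) α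
  reindex-id {X} f≈id α = Fibre.trans X (R₁.F-resp-≈ f≈id α) (R₁.identity α)

  reindex-∘ : ∀ {X Y Z} {f : X ⇒ Y} {g : Y ⇒ Z} {h : X ⇒ Z} → g ∘ f ≈ h → ∀ α →
              Fibre._≈_ X (reindex f (reindex g α)) (reindex h α)
  reindex-∘ {X} gf≈h α =
    Fibre.trans X (Fibre.sym X (R₁.homomorphism α)) (R₁.F-resp-≈ gf≈h α)

  reindex-section : ∀ {X Y} {s : X ⇒ Y} {f : Y ⇒ X} → f ∘ s ≈ id → ∀ α →
                    Fibre._≈_ X (reindex s (reindex f α)) α
  reindex-section {X} fs≈id α = Fibre.trans X (reindex-∘ fs≈id α) (R₁.identity α)

  reindex-square : ∀ {X Y Y′ Z} {f : X ⇒ Y} {g : Y ⇒ Z} {h : X ⇒ Y′} {k : Y′ ⇒ Z} →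
                   g ∘ f ≈ k ∘ h → ∀ α →
                   Fibre._≈_ X (reindex f (reindex g α)) (reindex h (reindex k α))
  reindex-square {X} gf≈kh α =
    Fibre.trans X (reindex-∘ gf≈kh α) (Fibre.sym X (reindex-∘ Equiv.refl α))

  reindex-mono : ∀ {X Y} (f : X ⇒ Y) {α β} → Fibre._≤_ Y α β →
                 Fibre._≤_ X (reindex f α) (reindex f β)
  reindex-mono {X} f α≤β =
    Fibre.trans X (reindex-congʳ f α≤β) (BooleanHom.∧-homo (R₁.F₁ f) _ _)

  ≤-resp : ∀ X {α α′ β β′} → Fibre._≈_ X α α′ → Fibre._≈_ X β β′ →
           Fibre._≤_ X α β → Fibre._≤_ X α′ β′
  ≤-resp X α≈α′ β≈β′ α≤β =
    Fibre.trans X (Fibre.sym X α≈α′) (Fibre.trans X α≤β (Fibre.∧-cong X α≈α′ β≈β′))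

module FirstOrderProperties {o ℓ e c r} {C : CartesianCategory o ℓ e}
         (R : FirstOrderDoctrine C c r) where
  open CartesianCategory C
  open CartesianProperties C
  open FirstOrderDoctrine R using (doctrine; all; all-mono; adjoint; beck-chevalley)
  open DoctrineProperties doctrine

  all-cong : ∀ Y X {α β} → Fibre._≈_ (X ⊗ Y) α β → Fibre._≈_ X (all Y X α) (all Y X β)
  all-cong Y X α≈β = Order.antisym X
    (all-mono Y X (Order.≤-reflexive (X ⊗ Y) α≈β))
    (all-mono Y X (Order.≤-reflexive (X ⊗ Y) (Fibre.sym (X ⊗ Y) α≈β)))

  -- Strictly equal functors have values at `Y` that are only propositionally equal, so
  -- Beck-Chevalley must also rename the quantified object; matching on `refl` reduces `hid` to
  -- `id`.
  reindex-all : ∀ {Y Y′ X X′} (f : X′ ⇒ X) (Y′≡Y : Y′ ≡ Y) (α : ∣ X ⊗ Y ∣) →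
                Fibre._≈_ X′ (reindex f (all Y X α)) (all Y′ X′ (reindex (f ⊗₁ hid Y′≡Y) α))
  reindex-all f refl α = beck-chevalley _ f α

  -- The map `s` makes `⟨ id , s ⟩` a section of `π₁`; reindexing the counit of the adjunction along
  -- it gives one inequality, and the unit is the other.
  all-weaken : ∀ {Y X} → X ⇒ Y → ∀ α → Fibre._≈_ X (all Y X (reindex π₁ α)) α
  all-weaken {Y} {X} s α = Order.antisym X
    (≤-resp X (reindex-section project₁ _) (reindex-section project₁ α)
      (reindex-mono ⟨ id , s ⟩ (proj₂ (adjoint Y X) (Order.≤-refl X))))
    (proj₁ (adjoint Y X) (Order.≤-refl (X ⊗ Y)))

-- The doctrine of formulas.

module Free {o ℓ e c r} {C : CartesianCategory o ℓ e} (P : BooleanDoctrine C c r) where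
  open CartesianCategory C using (Obj; _⇒_; id; _∘_; _⊗_; _⊗₁_; π₁)
  private
    module C = CartesianCategory C
    module P = BooleanDoctrine P

  infixr 7 _∧_
  infixr 6 _∨_

  -- Substitution is a constructor: its action is imposed by _≃_.
  data Formula : Obj → Set (o ⊔ ℓ ⊔ e ⊔ c ⊔ r) where
    atom    : ∀ {X} → P.∣ X ∣ → Formula X
    _∨_ _∧_ : ∀ {X} → Formula X → Formula X → Formula X
    ¬_      : ∀ {X} → Formula X → Formula X
    ⊤ ⊥     : ∀ {X} → Formula X
    sub     : ∀ {X Y} → X ⇒ Y → Formula Y → Formula X
    all     : ∀ Y {X} → Formula (X ⊗ Y) → Formula X

  infix 4 _≃_
  -- Exactly what a first-order Boolean doctrine and a natural Boolean homomorphism `atom` require.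
  -- Compatibility of `atom` and `sub` with `∨`, `⊤` and `⊥` is derived by `∧-¬-booleanHom`,
  -- congruence of `all` from `all-mono`.
  data _≃_ : ∀ {X} → Formula X → Formula X → Set (o ⊔ ℓ ⊔ e ⊔ c ⊔ r) where
    ≃-refl        : ∀ {X} {φ : Formula X} → φ ≃ φ
    ≃-sym         : ∀ {X} {φ ψ : Formula X} → φ ≃ ψ → ψ ≃ φ
    ≃-trans       : ∀ {X} {φ ψ χ : Formula X} → φ ≃ ψ → ψ ≃ χ → φ ≃ χ

    ∨-comm        : ∀ {X} (φ ψ : Formula X) → φ ∨ ψ ≃ ψ ∨ φ
    ∨-assoc       : ∀ {X} (φ ψ χ : Formula X) → (φ ∨ ψ) ∨ χ ≃ φ ∨ (ψ ∨ χ)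
    ∨-cong        : ∀ {X} {φ φ′ ψ ψ′ : Formula X} → φ ≃ φ′ → ψ ≃ ψ′ → φ ∨ ψ ≃ φ′ ∨ ψ′
    ∧-comm        : ∀ {X} (φ ψ : Formula X) → φ ∧ ψ ≃ ψ ∧ φ
    ∧-assoc       : ∀ {X} (φ ψ χ : Formula X) → (φ ∧ ψ) ∧ χ ≃ φ ∧ (ψ ∧ χ)
    ∧-cong        : ∀ {X} {φ φ′ ψ ψ′ : Formula X} → φ ≃ φ′ → ψ ≃ ψ′ → φ ∧ ψ ≃ φ′ ∧ ψ′
    ∨-absorbs-∧   : ∀ {X} (φ ψ : Formula X) → φ ∨ φ ∧ ψ ≃ φ
    ∧-absorbs-∨   : ∀ {X} (φ ψ : Formula X) → φ ∧ (φ ∨ ψ) ≃ φ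
    ∨-distribʳ-∧  : ∀ {X} (φ ψ χ : Formula X) → ψ ∧ χ ∨ φ ≃ (ψ ∨ φ) ∧ (χ ∨ φ)
    ∨-complementʳ : ∀ {X} (φ : Formula X) → φ ∨ ¬ φ ≃ ⊤
    ∧-complementʳ : ∀ {X} (φ : Formula X) → φ ∧ ¬ φ ≃ ⊥
    ¬-cong        : ∀ {X} {φ ψ : Formula X} → φ ≃ ψ → ¬ φ ≃ ¬ ψ

    atom-cong     : ∀ {X} {α β : P.∣ X ∣} → P.Fibre._≈_ X α β → atom α ≃ atom β
    atom-∧        : ∀ {X} (α β : P.∣ X ∣) → atom (P.Fibre._∧_ X α β) ≃ atom α ∧ atom β
    atom-¬        : ∀ {X} (α : P.∣ X ∣) → atom (P.Fibre.¬_ X α) ≃ ¬ atom α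
    atom-sub      : ∀ {X Y} (f : X ⇒ Y) (α : P.∣ Y ∣) → atom (P.reindex f α) ≃ sub f (atom α)

    sub-cong      : ∀ {X Y} {f g : X ⇒ Y} {φ ψ} → f C.≈ g → φ ≃ ψ → sub f φ ≃ sub g ψ
    sub-id        : ∀ {X} (φ : Formula X) → sub id φ ≃ φ
    sub-∘         : ∀ {X Y Z} (f : X ⇒ Y) (g : Y ⇒ Z) φ → sub (g ∘ f) φ ≃ sub f (sub g φ)
    sub-∧         : ∀ {X Y} (f : X ⇒ Y) φ ψ → sub f (φ ∧ ψ) ≃ sub f φ ∧ sub f ψ
    sub-¬         : ∀ {X Y} (f : X ⇒ Y) φ → sub f (¬ φ) ≃ ¬ sub f φ

    -- The order φ ≤ ψ of the fibres is φ ≃ φ ∧ ψ.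
    all-mono      : ∀ Y {X} {φ ψ : Formula (X ⊗ Y)} → φ ≃ φ ∧ ψ →
                    all Y φ ≃ all Y φ ∧ all Y ψ
    all-intro     : ∀ Y {X} {φ : Formula X} {ψ} → sub π₁ φ ≃ sub π₁ φ ∧ ψ →
                    φ ≃ φ ∧ all Y ψ
    all-elim      : ∀ Y {X} {φ : Formula X} {ψ} → φ ≃ φ ∧ all Y ψ →
                    sub π₁ φ ≃ sub π₁ φ ∧ ψ
    sub-all       : ∀ Y {X′ X} (f : X′ ⇒ X) (φ : Formula (X ⊗ Y)) →
                    sub f (all Y φ) ≃ all Y (sub (f ⊗₁ id) φ)

  formulas : Obj → BooleanAlgebra (o ⊔ ℓ ⊔ e ⊔ c ⊔ r) (o ⊔ ℓ ⊔ e ⊔ c ⊔ r)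
  formulas X = record
    { Carrier          = Formula X
    ; _≈_              = _≃_
    ; _∨_              = _∨_
    ; _∧_              = _∧_
    ; ¬_               = ¬_
    ; ⊤                = ⊤
    ; ⊥                = ⊥
    ; isBooleanAlgebra = isBooleanAlgebraʳ (record
      { isDistributiveLattice = isDistributiveLatticeʳʲᵐ (record
        { isLattice    = record
          { isEquivalence = record { refl = ≃-refl ; sym = ≃-sym ; trans = ≃-trans }
          ; ∨-comm        = ∨-comm
          ; ∨-assoc       = ∨-assoc
          ; ∨-cong        = ∨-cong
          ; ∧-comm        = ∧-comm
          ; ∧-assoc       = ∧-assoc
          ; ∧-cong        = ∧-cong
          ; absorptive    = ∨-absorbs-∧ , ∧-absorbs-∨
          }
        ; ∨-distribʳ-∧ = ∨-distribʳ-∧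
        })
      ; ∨-complementʳ         = ∨-complementʳ
      ; ∧-complementʳ         = ∧-complementʳ
      ; ¬-cong                = ¬-cong
      })
    }

  doctrine : BooleanDoctrine C (o ⊔ ℓ ⊔ e ⊔ c ⊔ r) (o ⊔ ℓ ⊔ e ⊔ c ⊔ r)
  doctrine = record { functor = record
    { F₀           = formulas
    ; F₁           = λ {Y} {X} f → ∧-¬-booleanHom (formulas Y) (formulas X) (sub f)
                       (sub-cong C.Equiv.refl) (sub-∧ f) (sub-¬ f)
    ; identity     = sub-id
    ; homomorphism = λ {_} {_} {_} {g} {f} → sub-∘ f g
    ; F-resp-≈     = λ f≈g _ → sub-cong f≈g ≃-refl
    } }

  firstOrder : FirstOrderDoctrine C (o ⊔ ℓ ⊔ e ⊔ c ⊔ r) (o ⊔ ℓ ⊔ e ⊔ c ⊔ r)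
  firstOrder = record
    { doctrine     = doctrine
    ; isFirstOrder = record
      { all            = λ Y X → all Y
      ; all-mono       = λ Y X → all-mono Y
      ; adjoint        = λ Y X → all-intro Y , all-elim Y
      ; beck-chevalley = λ Y → sub-all Y
      }
    }

  inclusion : P ⇒ᴺ doctrine
  inclusion = record
    { component = λ X → ∧-¬-booleanHom (P.fibre X) (formulas X) atom atom-cong atom-∧ atom-¬
    ; natural   = atom-sub
    }

-- Product comparison maps of a functor.

module Comparison {o ℓ e o′ ℓ′ e′}
         (C : CartesianCategory o ℓ e) (D : CartesianCategory o′ ℓ′ e′)
         (F : Functor (CartesianCategory.category C) (CartesianCategory.category D))
         (preserves : PreservesFiniteProducts F) where
  private module C = CartesianCategory C
  open CartesianCategory D
  open CartesianProperties D
  open Functor F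

  module _ {X Y : C.Obj} where
    imageIsProduct : IsProduct category (F₁ (C.π₁ {X} {Y})) (F₁ (C.π₂ {X} {Y}))
    imageIsProduct = PreservesFiniteProducts.product preserves C.isProduct
    private module FP = IsProduct imageIsProduct

    comparison : F₀ X ⊗ F₀ Y ⇒ F₀ (X C.⊗ Y)
    comparison = FP.⟨ π₁ , π₂ ⟩

    comparison⁻¹ : F₀ (X C.⊗ Y) ⇒ F₀ X ⊗ F₀ Y
    comparison⁻¹ = ⟨ F₁ C.π₁ , F₁ C.π₂ ⟩

    F₁π₁∘comparison : F₁ C.π₁ ∘ comparison ≈ π₁
    F₁π₁∘comparison = FP.project₁

    F₁π₂∘comparison : F₁ C.π₂ ∘ comparison ≈ π₂
    F₁π₂∘comparison = FP.project₂

    comparison∘comparison⁻¹ : comparison ∘ comparison⁻¹ ≈ id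
    comparison∘comparison⁻¹ = jointly-monic imageIsProduct
      (Equiv.trans (pullˡ {C = category} FP.project₁) (Equiv.trans project₁ (Equiv.sym identityʳ)))
      (Equiv.trans (pullˡ {C = category} FP.project₂) (Equiv.trans project₂ (Equiv.sym identityʳ)))

  F₁-square : ∀ {W X Y Z} {f : W C.⇒ X} {g : X C.⇒ Y} {h : W C.⇒ Z} {k : Z C.⇒ Y} →
              g C.∘ f C.≈ k C.∘ h → F₁ g ∘ F₁ f ≈ F₁ k ∘ F₁ h
  F₁-square p = Equiv.trans (Equiv.sym homomorphism) (Equiv.trans (F-resp-≈ p) homomorphism)

  -- Both sides agree after each projection of the image product. This is what carries
  -- Beck-Chevalley through evaluation.
  comparison-natural : ∀ {X′ X Y} (f : X′ C.⇒ X) →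
    comparison ∘ (F₁ f ⊗₁ id) ≈ F₁ (f C.⊗₁ C.id) ∘ comparison {X′} {Y}
  comparison-natural f = jointly-monic imageIsProduct
    (Equiv.trans (pullˡ {C = category} F₁π₁∘comparison)
      (Equiv.trans project₁
        (Equiv.sym (Equiv.trans (pullˡ {C = category} (F₁-square C.project₁))
          (Equiv.trans assoc (∘-resp-≈ Equiv.refl F₁π₁∘comparison))))))
    (Equiv.trans (pullˡ {C = category} F₁π₂∘comparison)
      (Equiv.trans project₂
        (Equiv.sym (Equiv.trans (pullˡ {C = category} (F₁-square C.project₂))
          (Equiv.trans assoc (∘-resp-≈ identity F₁π₂∘comparison))))))

-- Evaluation of formulas and its universal property.

module Evaluation {o ℓ e c r o′ ℓ′ e′ c′ r′}
         {C : CartesianCategory o ℓ e} {D : CartesianCategory o′ ℓ′ e′}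
         (P : BooleanDoctrine C c r) (R : FirstOrderDoctrine D c′ r′)
         (M : DoctrineMorphism P (FirstOrderDoctrine.doctrine R)) where
  open Free P hiding (doctrine)
  private
    module C = CartesianCategory C
    module D = CartesianCategory D
    module R = FirstOrderDoctrine R
    module M = DoctrineMorphism M
  open D using (_∘_; hid; _⊗₁_; π₁; π₂; ⟨_,_⟩; project₁; project₂; module Equiv)
  open DoctrineProperties R.doctrine
  open FirstOrderProperties R
  open Comparison C D M.functor M.preserves

  eval : ∀ {X} → Formula X → R.∣ M.F₀ X ∣
  eval {X} (atom α) = M.η X α
  eval {X} (φ ∨ ψ)  = Fibre._∨_ (M.F₀ X) (eval φ) (eval ψ)
  eval {X} (φ ∧ ψ)  = Fibre._∧_ (M.F₀ X) (eval φ) (eval ψ)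
  eval {X} (¬ φ)    = Fibre.¬_ (M.F₀ X) (eval φ)
  eval {X} ⊤        = Fibre.⊤ (M.F₀ X)
  eval {X} ⊥        = Fibre.⊥ (M.F₀ X)
  eval (sub f φ)    = reindex (M.F₁ f) (eval φ)
  eval {X} (all Y φ) = R.all (M.F₀ Y) (M.F₀ X) (reindex comparison (eval φ))

  eval-cong : ∀ {X} {φ ψ : Formula X} → φ ≃ ψ → Fibre._≈_ (M.F₀ X) (eval φ) (eval ψ)
  eval-cong {X} ≃-refl                = Fibre.refl (M.F₀ X)
  eval-cong {X} (≃-sym p)             = Fibre.sym (M.F₀ X) (eval-cong p)
  eval-cong {X} (≃-trans p q)         = Fibre.trans (M.F₀ X) (eval-cong p) (eval-cong q)
  eval-cong {X} (∨-comm _ _)          = Fibre.∨-comm (M.F₀ X) _ _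
  eval-cong {X} (∨-assoc _ _ _)       = Fibre.∨-assoc (M.F₀ X) _ _ _
  eval-cong {X} (∨-cong p q)          = Fibre.∨-cong (M.F₀ X) (eval-cong p) (eval-cong q)
  eval-cong {X} (∧-comm _ _)          = Fibre.∧-comm (M.F₀ X) _ _
  eval-cong {X} (∧-assoc _ _ _)       = Fibre.∧-assoc (M.F₀ X) _ _ _
  eval-cong {X} (∧-cong p q)          = Fibre.∧-cong (M.F₀ X) (eval-cong p) (eval-cong q)
  eval-cong {X} (∨-absorbs-∧ _ _)     = Fibre.∨-absorbs-∧ (M.F₀ X) _ _
  eval-cong {X} (∧-absorbs-∨ _ _)     = Fibre.∧-absorbs-∨ (M.F₀ X) _ _
  eval-cong {X} (∨-distribʳ-∧ _ _ _)  = Fibre.∨-distribʳ-∧ (M.F₀ X) _ _ _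
  eval-cong {X} (∨-complementʳ _)     = Fibre.∨-complementʳ (M.F₀ X) _
  eval-cong {X} (∧-complementʳ _)     = Fibre.∧-complementʳ (M.F₀ X) _
  eval-cong {X} (¬-cong p)            = Fibre.¬-cong (M.F₀ X) (eval-cong p)
  eval-cong {X} (atom-cong p)         = BooleanHom.⟦⟧-cong (M.component X) p
  eval-cong {X} (atom-∧ α β)          = BooleanHom.∧-homo (M.component X) α β
  eval-cong {X} (atom-¬ α)            = BooleanHom.¬-homo (M.component X) α
  eval-cong (atom-sub f α)            = M.natural f α
  eval-cong (sub-cong f≈g p)          = reindex-cong (M.F-resp-≈ f≈g) (eval-cong p)
  eval-cong (sub-id φ)                = reindex-id M.identity (eval φ)
  eval-cong {X} (sub-∘ f g φ)         =
    Fibre.sym (M.F₀ X) (reindex-∘ (Equiv.sym M.homomorphism) (eval φ))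
  eval-cong (sub-∧ f φ ψ)             =
    BooleanHom.∧-homo (Functor.F₁ R.functor (M.F₁ f)) (eval φ) (eval ψ)
  eval-cong (sub-¬ f φ)               =
    BooleanHom.¬-homo (Functor.F₁ R.functor (M.F₁ f)) (eval φ)
  eval-cong {X} (all-mono Y p)        =
    R.all-mono (M.F₀ Y) (M.F₀ X) (reindex-mono comparison (eval-cong p))
  eval-cong {X} (all-intro Y {φ = φ} p) =
    -- Reindexing along `comparison` replaces the image of `π₁` by the chosen projection, to which
    -- the adjunction in `R` applies.
    proj₁ (R.adjoint (M.F₀ Y) (M.F₀ X))
      (≤-resp _ (reindex-∘ F₁π₁∘comparison (eval φ)) (Fibre.refl _)
        (reindex-mono comparison (eval-cong p)))
  eval-cong (all-elim Y {X} {φ} {ψ} p) =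
    -- Conversely, `comparison⁻¹` leads from the chosen product back to the image product and
    -- cancels `comparison`.
    ≤-resp _ (reindex-∘ project₁ (eval φ)) (reindex-section comparison∘comparison⁻¹ (eval ψ))
      (reindex-mono comparison⁻¹ (proj₂ (R.adjoint (M.F₀ Y) (M.F₀ X)) (eval-cong p)))
  eval-cong (sub-all Y {X′} {X} f φ)  =
    Fibre.trans (M.F₀ X′) (R.beck-chevalley (M.F₀ Y) (M.F₁ f) _)
      (all-cong (M.F₀ Y) (M.F₀ X′) (reindex-square (comparison-natural f) (eval φ)))

  evaluation : FirstOrderMorphism firstOrder R
  evaluation = record
    { morphism      = record
      { functor   = M.functor
      ; preserves = M.preserves
      ; transf    = record
        -- These equations, naturality and `preserves-all` are the clauses of `eval`, hence
        -- reflexivity proves them.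
        { component = λ X → ∧-¬-booleanHom (formulas X) (R.fibre (M.F₀ X)) eval eval-cong
            (λ _ _ → Fibre.refl (M.F₀ X)) (λ _ → Fibre.refl (M.F₀ X))
        ; natural   = λ {X} f φ → Fibre.refl (M.F₀ X)
        }
      }
    ; preserves-all = λ Y X φ → Fibre.refl (M.F₀ X)
    }

  open FirstOrderMorphism using (morphism)

  evaluation-extends : M ≈ᴰ (morphism evaluation ∘ᴰ overIdentity inclusion)
  evaluation-extends = record
    { functor≡ = record
      { eq₀ = λ X → refl
      ; eq₁ = λ f → Equiv.trans D.identityˡ (Equiv.sym D.identityʳ)
      }
    ; transf≈  = λ X α → Fibre.sym (M.F₀ X) (reindex-id Equiv.refl (M.η X α))
    }

  module _ (N : FirstOrderMorphism firstOrder R)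
           (M≈N∘I : M ≈ᴰ (morphism N ∘ᴰ overIdentity inclusion)) where
    private
      module N = FirstOrderMorphism N
      module CN = Comparison C D N.functor N.preserves
      module H = _≈ᴰ_ M≈N∘I
      h : ∀ X → M.F₀ X D.⇒ N.F₀ X
      h X = hid (H.eq₀ X)
      module h* (X : C.Obj) = BooleanHom (Functor.F₁ R.functor (h X))

    -- By `eq₁` the identifications `h` are natural, in particular at the two projections, and these
    -- detect equality of maps into the image product.
    comparison-hid : ∀ {X Y} → CN.comparison ∘ (h X ⊗₁ h Y) D.≈ h (X C.⊗ Y) ∘ comparison
    comparison-hid = jointly-monic CN.imageIsProduct
      (Equiv.trans (pullˡ {C = D.category} CN.F₁π₁∘comparison)
        (Equiv.trans project₁
          (Equiv.sym (Equiv.trans (pullˡ {C = D.category} (Equiv.sym (H.eq₁ C.π₁)))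
            (Equiv.trans D.assoc (D.∘-resp-≈ Equiv.refl F₁π₁∘comparison))))))
      (Equiv.trans (pullˡ {C = D.category} CN.F₁π₂∘comparison)
        (Equiv.trans project₂
          (Equiv.sym (Equiv.trans (pullˡ {C = D.category} (Equiv.sym (H.eq₁ C.π₂)))
            (Equiv.trans D.assoc (D.∘-resp-≈ Equiv.refl F₁π₂∘comparison))))))

    -- Induction on the formula: `N` and reindexing along `h` commute with every constructor, and
    -- atoms are the hypothesis on `N`.
    eval-unique : ∀ {X} (φ : Formula X) →
                  Fibre._≈_ (M.F₀ X) (eval φ) (reindex (h X) (N.η X φ))
    eval-unique {X} (atom α) = H.transf≈ X α
    eval-unique {X} (φ ∨ ψ)  = begin
      eval (φ ∨ ψ)                      ≈⟨ Fibre.∨-cong (M.F₀ X) (eval-unique φ) (eval-unique ψ) ⟩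
      _                                 ≈⟨ h*.∨-homo X _ _ ⟨
      _                                 ≈⟨ reindex-congʳ (h X) (BooleanHom.∨-homo (N.component X) φ ψ) ⟨
      reindex (h X) (N.η X (φ ∨ ψ))     ∎
      where open ≈-Reasoning (fibreSetoid (M.F₀ X))
    eval-unique {X} (φ ∧ ψ)  = begin
      eval (φ ∧ ψ)                      ≈⟨ Fibre.∧-cong (M.F₀ X) (eval-unique φ) (eval-unique ψ) ⟩
      _                                 ≈⟨ h*.∧-homo X _ _ ⟨
      _                                 ≈⟨ reindex-congʳ (h X) (BooleanHom.∧-homo (N.component X) φ ψ) ⟨
      reindex (h X) (N.η X (φ ∧ ψ))     ∎
      where open ≈-Reasoning (fibreSetoid (M.F₀ X))
    eval-unique {X} (¬ φ)    = begin
      eval (¬ φ)                        ≈⟨ Fibre.¬-cong (M.F₀ X) (eval-unique φ) ⟩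
      _                                 ≈⟨ h*.¬-homo X _ ⟨
      _                                 ≈⟨ reindex-congʳ (h X) (BooleanHom.¬-homo (N.component X) φ) ⟨
      reindex (h X) (N.η X (¬ φ))       ∎
      where open ≈-Reasoning (fibreSetoid (M.F₀ X))
    eval-unique {X} ⊤        = Fibre.sym (M.F₀ X) (Fibre.trans (M.F₀ X)
      (reindex-congʳ (h X) (BooleanHom.⊤-homo (N.component X))) (h*.⊤-homo X))
    eval-unique {X} ⊥        = Fibre.sym (M.F₀ X) (Fibre.trans (M.F₀ X)
      (reindex-congʳ (h X) (BooleanHom.⊥-homo (N.component X))) (h*.⊥-homo X))
    eval-unique {X} (sub {Y = Y} f φ) = begin
      reindex (M.F₁ f) (eval φ)                      ≈⟨ reindex-congʳ (M.F₁ f) (eval-unique φ) ⟩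
      reindex (M.F₁ f) (reindex (h Y) (N.η Y φ))     ≈⟨ reindex-square (H.eq₁ f) (N.η Y φ) ⟩
      reindex (h X) (reindex (N.F₁ f) (N.η Y φ))     ≈⟨ reindex-congʳ (h X) (N.natural f φ) ⟨
      reindex (h X) (N.η X (sub f φ))                ∎
      where open ≈-Reasoning (fibreSetoid (M.F₀ X))
    eval-unique {X} (all Y φ) = begin
      R.all (M.F₀ Y) (M.F₀ X) (reindex comparison (eval φ))
        ≈⟨ all-cong (M.F₀ Y) (M.F₀ X) (reindex-congʳ comparison (eval-unique φ)) ⟩
      R.all (M.F₀ Y) (M.F₀ X) (reindex comparison (reindex (h (X C.⊗ Y)) (N.η (X C.⊗ Y) φ)))
        ≈⟨ all-cong (M.F₀ Y) (M.F₀ X) (reindex-square comparison-hid (N.η (X C.⊗ Y) φ)) ⟨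
      R.all (M.F₀ Y) (M.F₀ X)
        (reindex (h X ⊗₁ h Y) (reindex CN.comparison (N.η (X C.⊗ Y) φ)))
        ≈⟨ reindex-all (h X) (H.eq₀ Y) _ ⟨
      reindex (h X) (R.all (N.F₀ Y) (N.F₀ X) (reindex CN.comparison (N.η (X C.⊗ Y) φ)))
        ≈⟨ reindex-congʳ (h X) (N.preserves-all Y X φ) ⟨
      reindex (h X) (N.η X (all Y φ))
        ∎
      where open ≈-Reasoning (fibreSetoid (M.F₀ X))

    evaluation-unique : morphism evaluation ≈ᴰ morphism N
    evaluation-unique = record
      -- The inclusion lies over the identity, so the given equality of base functors serves again.
      { functor≡ = record { eq₀ = H.eq₀ ; eq₁ = H.eq₁ }
      ; transf≈  = λ X → eval-unique
      }

free-isQuantifierCompletion : ∀ {o ℓ e c r} {C : CartesianCategory o ℓ e}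
  (P : BooleanDoctrine C c r) →
  IsQuantifierCompletion P (Free.firstOrder P) (overIdentity (Free.inclusion P))
free-isQuantifierCompletion P = record
  { universal = λ R M → let open Evaluation P R M in
      evaluation , evaluation-extends , λ {N} → evaluation-unique N
  }

module _ {o ℓ e} (C : Category o ℓ e) where
  open Category C

  hid-inverseʳ : ∀ {X Y} (p : X ≡ Y) → hid p ∘ hid (≡-sym p) ≈ id
  hid-inverseʳ refl = identityˡ

-- Strata over the image of `P`.

module Strata {o ℓ e c r c′ r′} {C : CartesianCategory o ℓ e}
         {P : BooleanDoctrine C c r} (Q : FirstOrderDoctrine C c′ r′)
         (i : P ⇒ᴺ FirstOrderDoctrine.doctrine Q) where
  open CartesianCategory C
  open FirstOrderDoctrine Q using (doctrine; beck-chevalley)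
  open DoctrineProperties doctrine
  open FirstOrderProperties Q
  open _⇒ᴺ_ i
  private
    module P = BooleanDoctrine P
    module reindexHom {X Y} (f : X ⇒ Y) = BooleanHom (Functor.F₁ functor f)

  image-isSubalgebra : ∀ X → IsBooleanSubalgebra (fibre X) (Image i X)
  image-isSubalgebra X = record
    { resp     = λ φ≈ψ (α , iα≈φ) → α , trans iα≈φ φ≈ψ
    ; ⊤-closed = P.Fibre.⊤ X , ⊤-homo
    ; ⊥-closed = P.Fibre.⊥ X , ⊥-homo
    ; ∧-closed = λ (α , p) (β , q) → P.Fibre._∧_ X α β , trans (∧-homo α β) (∧-cong p q)
    ; ∨-closed = λ (α , p) (β , q) → P.Fibre._∨_ X α β , trans (∨-homo α β) (∨-cong p q)
    ; ¬-closed = λ (α , p) → P.Fibre.¬_ X α , trans (¬-homo α) (¬-cong p)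
    }
    where
    open BooleanHom (component X)
    open Fibre X

  image-isSubfunctor : ∀ {X Y} (f : X ⇒ Y) {φ} → φ ∈ Image i Y → reindex f φ ∈ Image i X
  image-isSubfunctor {X} f (α , iα≈φ) =
    P.reindex f α , Fibre.trans X (natural f α) (reindex-congʳ f iα≈φ)

  InStratum : ℕ → ∀ X → Pred ∣ X ∣ _
  InStratum = Stratum Q (Image i)

  stratum-resp : ∀ n {X φ ψ} → Fibre._≈_ X φ ψ → φ ∈ InStratum n X → ψ ∈ InStratum n X
  stratum-resp zero {X} φ≈ψ (lift φ∈) =
    lift (IsBooleanSubalgebra.resp (image-isSubalgebra X) φ≈ψ φ∈)
  stratum-resp (suc n) φ≈ψ φ∈ = resp φ≈ψ φ∈

  -- Beck-Chevalley moves `f` under the quantifier of a generator, as `f ⊗₁ id` one stratum lower;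
  -- the Boolean operations are preserved by reindexing.
  stratum-reindex : ∀ n {X Y} (f : X ⇒ Y) {φ} →
                    φ ∈ InStratum n Y → reindex f φ ∈ InStratum n X
  stratum-reindex zero    f (lift φ∈)   = lift (image-isSubfunctor f φ∈)
  stratum-reindex (suc n) {X} f (gen (Z , ψ , ψ∈ , ∀ψ≈φ)) =
    gen (Z , reindex (f ⊗₁ id) ψ , stratum-reindex n (f ⊗₁ id) ψ∈ ,
      Fibre.trans X (Fibre.sym X (beck-chevalley Z f ψ)) (reindex-congʳ f ∀ψ≈φ))
  stratum-reindex (suc n) f (resp φ≈ψ φ∈) =
    resp (reindex-congʳ f φ≈ψ) (stratum-reindex (suc n) f φ∈)
  stratum-reindex (suc n) {X} f top     = resp (Fibre.sym X (reindexHom.⊤-homo f)) top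
  stratum-reindex (suc n) {X} f bot     = resp (Fibre.sym X (reindexHom.⊥-homo f)) bot
  stratum-reindex (suc n) {X} f (meet φ∈ ψ∈) = resp (Fibre.sym X (reindexHom.∧-homo f _ _))
    (meet (stratum-reindex (suc n) f φ∈) (stratum-reindex (suc n) f ψ∈))
  stratum-reindex (suc n) {X} f (join φ∈ ψ∈) = resp (Fibre.sym X (reindexHom.∨-homo f _ _))
    (join (stratum-reindex (suc n) f φ∈) (stratum-reindex (suc n) f ψ∈))
  stratum-reindex (suc n) {X} f (neg φ∈) = resp (Fibre.sym X (reindexHom.¬-homo f _))
    (neg (stratum-reindex (suc n) f φ∈))

  -- Quantify vacuously over `𝟙`: the map from `X` to `𝟙` lets `all-weaken` undo the weakening.
  stratum-suc : ∀ n {X φ} → φ ∈ InStratum n X → φ ∈ InStratum (suc n) X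
  stratum-suc n φ∈ =
    gen (𝟙 , _ , stratum-reindex n π₁ φ∈ , all-weaken (IsTerminal.! isTerminal) _)

  stratum-mono : ∀ {m n X φ} → m ≤′ n → φ ∈ InStratum m X → φ ∈ InStratum n X
  stratum-mono ≤′-refl       φ∈ = φ∈
  stratum-mono (≤′-step m≤n) φ∈ = stratum-suc _ (stratum-mono m≤n φ∈)

  -- The index goes one past the maximum because a successor stratum is `Generated`, so that `meet`
  -- and `join` apply.
  stratum-common : ∀ {X φ ψ} → (∃ λ m → φ ∈ InStratum m X) → (∃ λ n → ψ ∈ InStratum n X) →
                   ∃ λ k → φ ∈ InStratum (suc k) X × ψ ∈ InStratum (suc k) X
  stratum-common (m , φ∈) (n , ψ∈) = m ⊔ⁿ n ,
    stratum-suc _ (stratum-mono (≤⇒≤′ (m≤m⊔n m n)) φ∈) ,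
    stratum-suc _ (stratum-mono (≤⇒≤′ (m≤n⊔m m n)) ψ∈)

  open Free P using (Formula; atom; _∨_; _∧_; ¬_; ⊤; ⊥; sub) renaming (all to ∀′)
  open Evaluation P Q (overIdentity i) using (eval)

  eval-exhausted : ∀ {X} (φ : Formula X) → ∃ λ n → eval φ ∈ InStratum n X
  eval-exhausted {X} (atom α) = 0 , lift (α , Fibre.refl X)
  eval-exhausted (φ ∨ ψ) =
    let k , φ∈ , ψ∈ = stratum-common (eval-exhausted φ) (eval-exhausted ψ) in suc k , join φ∈ ψ∈
  eval-exhausted (φ ∧ ψ) =
    let k , φ∈ , ψ∈ = stratum-common (eval-exhausted φ) (eval-exhausted ψ) in suc k , meet φ∈ ψ∈
  eval-exhausted (¬ φ) = let n , φ∈ = eval-exhausted φ in suc n , neg (stratum-suc n φ∈)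
  eval-exhausted ⊤ = 1 , top
  eval-exhausted ⊥ = 1 , bot
  eval-exhausted (sub f φ) = let n , φ∈ = eval-exhausted φ in n , stratum-reindex n f φ∈
  -- The formula under the quantifier is evaluated and then reindexed along a comparison map;
  -- `stratum-reindex` keeps it in its stratum.
  eval-exhausted {X} (∀′ Y φ) = let n , φ∈ = eval-exhausted φ in
    suc n , gen (Y , _ , stratum-reindex n _ φ∈ , Fibre.refl X)

-- Two morphisms equal to a third.

module _ {o ℓ e c r o′ ℓ′ e′ c′ r′}
         {C : CartesianCategory o ℓ e} {D : CartesianCategory o′ ℓ′ e′}
         {P : BooleanDoctrine C c r} {R : BooleanDoctrine D c′ r′}
         (U M N : DoctrineMorphism P R) where
  private
    module C = CartesianCategory C
    module M = DoctrineMorphism M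
    module N = DoctrineMorphism N
  open CartesianCategory D
  open DoctrineProperties R

  -- `h` passes back to the value of `U` at `X` and on to that of `N`. Its mere existence is
  -- recorded, since strata are closed under reindexing along any map.
  ≈ᴰ-agree : U ≈ᴰ M → U ≈ᴰ N → ∀ (X : C.Obj) α →
             ∃ λ (h : M.F₀ X ⇒ N.F₀ X) →
             Fibre._≈_ (M.F₀ X) (M.η X α) (reindex h (N.η X α))
  ≈ᴰ-agree U≈M U≈N X α = hid q ∘ hid (≡-sym p) ,
    Fibre.trans (M.F₀ X) (Fibre.sym (M.F₀ X) (reindex-section (hid-inverseʳ category p) (M.η X α)))
    (Fibre.trans (M.F₀ X) (reindex-congʳ (hid (≡-sym p))
      (Fibre.trans _ (Fibre.sym _ (U≈M.transf≈ X α)) (U≈N.transf≈ X α)))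
    (reindex-∘ Equiv.refl (N.η X α)))
    where
    module U≈M = _≈ᴰ_ U≈M
    module U≈N = _≈ᴰ_ U≈N
    p = U≈M.eq₀ X
    q = U≈N.eq₀ X

-- Injectivity and stratification for an arbitrary completion.

module Completion {o ℓ e c r c′ r′} {C : CartesianCategory o ℓ e}
         {P : BooleanDoctrine C c r} (Q : FirstOrderDoctrine C c′ r′)
         (i : P ⇒ᴺ FirstOrderDoctrine.doctrine Q)
         (completion : IsQuantifierCompletion P Q (overIdentity i)) where
  open CartesianCategory C
  open FirstOrderDoctrine Q using (doctrine; all)
  open DoctrineProperties doctrine
  open FirstOrderProperties Q
  open Strata Q i
  open FirstOrderMorphism using (morphism)
  open IsQuantifierCompletion completion
  private
    module I = _⇒ᴺ_ i

  -- The embedding into the pointwise doctrine at `X` factors through `i`. That embedding is known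
  -- to be injective only at its own base object, hence one target for each `X`.
  injective : ComponentwiseInjective i
  injective X {α} {β} iα≈iβ = principal-injective {α} {β} (begin
    principal X α                       ≈⟨ M≈N∘i.transf≈ X α ⟩
    R.reindex h (N.η X (I.η X α))       ≈⟨ R.reindex-congʳ h {N.η X (I.η X α)} {N.η X (I.η X β)}
                                               (BooleanHom.⟦⟧-cong (N.component X) iα≈iβ) ⟩
    R.reindex h (N.η X (I.η X β))       ≈⟨ M≈N∘i.transf≈ X β ⟨
    principal X β                       ∎)
    where
    open PointwiseDoctrine P X using (principal; principal-injective; firstOrder; embedding)
    module R = DoctrineProperties (FirstOrderDoctrine.doctrine firstOrder)
    N∃! = universal firstOrder (overIdentity embedding)
    module N = FirstOrderMorphism (proj₁ N∃!)
    module M≈N∘i = _≈ᴰ_ (proj₁ (proj₂ N∃!))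
    h = hid (M≈N∘i.eq₀ X)
    open ≈-Reasoning (R.fibreSetoid X)

  -- The comparison map of the identity functor is this pairing.
  ⟨π₁,π₂⟩≈id : ∀ {X Y} → ⟨ π₁ , π₂ ⟩ ≈ id {X ⊗ Y}
  ⟨π₁,π₂⟩≈id = unique identityʳ identityʳ

  idQ : FirstOrderMorphism Q Q
  idQ = record
    { morphism      = overIdentity record
      { component = λ X → idᴮ
      ; natural   = λ {X} f α → Fibre.refl X
      }
    ; preserves-all = λ Y X α → all-cong Y X {α} {reindex ⟨ π₁ , π₂ ⟩ α}
        (Fibre.sym (X ⊗ Y) (reindex-id ⟨π₁,π₂⟩≈id α))
    }

  idQ-extends : overIdentity i ≈ᴰ (morphism idQ ∘ᴰ overIdentity i)
  idQ-extends = record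
    { functor≡ = record
      { eq₀ = λ X → refl
      ; eq₁ = λ f → Equiv.trans identityˡ (Equiv.sym identityʳ)
      }
    ; transf≈  = λ X α → Fibre.sym X (reindex-id Equiv.refl (I.η X α))
    }

  -- `idQ` and `E` both factor `i` through itself, so both equal the unique such morphism. The map
  -- `h` absorbs the propositional equality of objects.
  endomorphism-fixes : (E : FirstOrderMorphism Q Q) →
                       overIdentity i ≈ᴰ (morphism E ∘ᴰ overIdentity i) → ∀ X φ →
                       ∃ λ (h : X ⇒ FirstOrderMorphism.F₀ E X) →
                       Fibre._≈_ X φ (reindex h (FirstOrderMorphism.η E X φ))
  endomorphism-fixes E E-extends =
    ≈ᴰ-agree (morphism (proj₁ U∃!)) (morphism idQ) (morphism E)
      (proj₂ (proj₂ U∃!) {idQ} idQ-extends) (proj₂ (proj₂ U∃!) {E} E-extends)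
    where
    U∃! = universal Q (overIdentity i)

  private
    module F = Free P
    module K = Evaluation P Q (overIdentity i)
    N∃! = universal F.firstOrder (overIdentity F.inclusion)
    module N = FirstOrderMorphism (proj₁ N∃!)
    module I≈N∘i = _≈ᴰ_ (proj₁ (proj₂ N∃!))

  K∘N : FirstOrderMorphism Q Q
  K∘N = record
    { morphism      = morphism K.evaluation ∘ᴰ N.morphism
    ; preserves-all = λ Y X α →
        let β = reindex (N.comparison X Y) (K.eval (N.η (X ⊗ Y) α)) in
        Fibre.trans (N.F₀ X) {j = all (N.F₀ Y) (N.F₀ X) (reindex ⟨ π₁ , π₂ ⟩ β)}
          (K.eval-cong (N.preserves-all Y X α))
          (all-cong (N.F₀ Y) (N.F₀ X) (reindex-id ⟨π₁,π₂⟩≈id β))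
    }

  K∘N-extends : overIdentity i ≈ᴰ (morphism K∘N ∘ᴰ overIdentity i)
  K∘N-extends = record
    { functor≡ = record { eq₀ = I≈N∘i.eq₀ ; eq₁ = I≈N∘i.eq₁ }
    -- Evaluate the equation of formulas that says that `N` extends the inclusion: `eval` turns
    -- `atom α` into `I.η X α` and `sub` into reindexing.
    ; transf≈  = λ X α → K.eval-cong
        {φ = F.atom α} {ψ = F.sub (hid (I≈N∘i.eq₀ X)) (N.η X (I.η X α))} (I≈N∘i.transf≈ X α)
    }

  -- Up to reindexing, `φ` is the value of the formula `N.η X φ`, and values of formulas lie in
  -- strata.
  exhausted : ∀ X φ → ∃ λ n → φ ∈ InStratum n X
  exhausted X φ =
    let h , φ≈  = endomorphism-fixes K∘N K∘N-extends X φ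
        n , Nφ∈ = eval-exhausted (N.η X φ)
    in n , stratum-resp n (Fibre.sym X φ≈) (stratum-reindex n h Nφ∈)

  isQuantifierFreeFragment : IsQuantifierFreeFragment Q (Image i)
  isQuantifierFreeFragment = record
    { isSubalgebra = image-isSubalgebra
    ; isSubfunctor = image-isSubfunctor
    ; exhaustive   = exhausted
    }

theorem5p10 : ∀ {o ℓ e c r : Level} (C : CartesianCategory o ℓ e) (P : BooleanDoctrine C c r) →
    (∃ω λ (Q : FirstOrderDoctrine C (o ⊔ ℓ ⊔ e ⊔ c ⊔ r) (o ⊔ ℓ ⊔ e ⊔ c ⊔ r)) →
    ∃ω λ (i : _⇒ᴺ_ P (FirstOrderDoctrine.doctrine Q)) →
    IsQuantifierCompletion P Q (overIdentity i))
    ×ω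
    (∀ {c′ r′ : Level} (Q : FirstOrderDoctrine C c′ r′)
    (i : _⇒ᴺ_ P (FirstOrderDoctrine.doctrine Q)) →
    IsQuantifierCompletion P Q (overIdentity i) →
    ComponentwiseInjective i × IsQuantifierFreeFragment Q (Image i))
theorem5p10 C P =
  (Free.firstOrder P ,ω Free.inclusion P ,ω free-isQuantifierCompletion P) ,
  λ Q i completion → let open Completion Q i completion in
    injective , isQuantifierFreeFragment
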